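{- $f(31,31)=8$, where $f(n,c)$ denotes the least integer $d$ such that every $n$-vertex graph with minimum degree at least $d$ contains a cycle with at least $c$ chords.
   Context: All graphs are finite and simple. A chord of a cycle $C$ in $G$ is an edge of $G$ joining two vertices of $C$ that are not consecutive on $C$. -}

module Defs where

open import Data.Nat using (ℕ; suc; _≤_)
open import Data.Nat.DivMod using (_mod_)
open import Data.Fin using (Fin; toℕ; _<_)
open import Data.Fin.Properties using (_≟_; _<?_)
open import Data.List using (List; length; filter; allFin; cartesianProduct)
open import Data.Product using (Σ-syntax; _×_; _,_)
open import Data.Sum using (_⊎_)
open import Function.Definitions using (Injective)
open import Level using (0ℓ)
open import Relation.Binary using (Rel; Decidable; Symmetric)
open import Relation.Binary.PropositionalEquality using (_≡_)
open import Relation.Nullary using (¬_; ¬?; _×-dec_; _⊎-dec_)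
import Relation.Unary as U

record Graph (n : ℕ) : Set₁ where
  field
    _~_    : Rel (Fin n) 0ℓ
    _~?_   : Decidable _~_
    ~-sym  : Symmetric _~_
    ~-irr  : ∀ v → ¬ (v ~ v)

  degree : Fin n → ℕ
  degree v = length (filter (v ~?_) (allFin n))

MinDegreeAtLeast : ∀ {n} → ℕ → Graph n → Set
MinDegreeAtLeast d G = ∀ v → d ≤ Graph.degree G v

-- Cyclic successor: i ↦ i + 1 modulo k.
next : ∀ {k} → Fin k → Fin k
next {suc k} i = suc (toℕ i) mod suc k

record Cycle {n : ℕ} (G : Graph n) : Set where
  open Graph G
  field
    len        : ℕ
    3≤len      : 3 ≤ len
    vertex     : Fin len → Fin n
    vertex-inj : Injective _≡_ _≡_ vertex
    edge       : ∀ i → vertex i ~ vertex (next i)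

  Consecutive : Rel (Fin len) 0ℓ
  Consecutive i j = next i ≡ j ⊎ next j ≡ i

  consecutive? : Decidable Consecutive
  consecutive? i j = (next i ≟ j) ⊎-dec (next j ≟ i)

  -- Since vertex is injective, pairs of positions i < j correspond exactly to
  -- unordered pairs of distinct vertices of the cycle, so each chord is
  -- represented by exactly one pair.
  IsChord : U.Pred (Fin len × Fin len) 0ℓ
  IsChord (i , j) = i < j × vertex i ~ vertex j × ¬ Consecutive i j

  isChord? : U.Decidable IsChord
  isChord? (i , j) =
    (i <? j) ×-dec (vertex i ~? vertex j) ×-dec ¬? (consecutive? i j)

  chords : List (Fin len × Fin len)
  chords = filter isChord? (cartesianProduct (allFin len) (allFin len))

  #chords : ℕ
  #chords = length chords

ForcesChords : ℕ → ℕ → ℕ → Set₁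
ForcesChords n c d =
  (G : Graph n) → MinDegreeAtLeast d G → Σ[ C ∈ Cycle G ] c ≤ Cycle.#chords C

-- The graph of the function f: "f(n,c) = d".  Thresholds range over ℕ rather
-- than ℤ; for n ≥ 1 this loses nothing, since the edgeless graph shows that
-- no threshold d ≤ 0 forces a cycle.
f⟨_,_⟩≡_ : ℕ → ℕ → ℕ → Set₁
f⟨ n , c ⟩≡ d = ForcesChords n c d × (∀ d′ → ForcesChords n c d′ → d ≤ d′)

{-# OPTIONS --safe #-}

-- Lower bound: a graph with components of orders 10, 10 and 11 whose degrees are 7, except for one 8.
--
-- Upper bound: suppose that no cycle has 31 chords.  Pósa rotation, applied to a path that cannot be
-- improved, yields a cycle C and a vertex z of C such that every Hamiltonian path of C ending in z
-- starts in a vertex with all its neighbours on C.  If another vertex of C had a neighbour outside C,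
-- then counting the edges between the inner and the outer vertices of C leaves a single possibility,
-- a Hamiltonian path that meets the inner vertices in exactly two blocks, and further rotations
-- refute it.  So z separates S = C ∖ {z} from the rest of the graph, and counting chords gives
-- 8 ≤ |S| ≤ 10 and deg_S(z) ≤ 62 − 6|S|.  After two such sets are removed, 11 to 15 vertices remain,
-- all but two of which still have degree at least 8; there a cycle of the same kind contains all
-- the vertices of degree at least 8 and has too many chords.
module Submission where

open import Defs

open import Data.Bool using (Bool; true; false; T; not; _∧_; _∨_; if_then_else_)
import Data.Bool.Properties as Bool
open import Data.Empty using (⊥; ⊥-elim)
open import Data.Fin using (Fin; zero; suc; _≟_; #_; toℕ; inject₁; fromℕ)
open import Data.Fin.Properties using (all?; any?; toℕ-injective; toℕ-fromℕ; toℕ-inject₁; toℕ-fromℕ<; toℕ<n)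
  renaming (<-cmp to Fin-<-cmp)
open import Data.Fin.Relation.Unary.Top using (view; ‵fromℕ; ‵inject₁)
open import Data.List using (List; []; _∷_; [_]; _++_; _ʳ++_; length; allFin; filter; map; tabulate; lookup;
    cartesianProduct)
open import Data.List.Membership.Propositional using (_∈_; _∉_)
open import Data.List.Membership.Propositional.Properties
  using (∈-lookup; ∈-∃++; ∈-allFin; ∈-++⁺ˡ; ∈-++⁺ʳ; ∈-++⁻; ∈-map⁻; ∈-filter⁺; ∈-filter⁻)
open import Data.List.Properties
  using (++-ʳ++; ++-assoc; ++-identityʳ; length-++; length-map; length-tabulate; tabulate-lookup; map-tabulate)
open import Data.List.Relation.Binary.Permutation.Propositional as Perm using
    (_↭_; ↭-refl; ↭-sym; ↭-trans; ↭⇒↭ₛ)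
open import Data.List.Relation.Binary.Permutation.Propositional.Properties using
    (shift; ++⁺ʳ; ∈-resp-↭; ++↭ʳ++; ↭-length)
import Data.List.Relation.Binary.Permutation.Setoid.Properties as SetoidPerm
open import Data.List.Relation.Unary.All as All using (All; []; _∷_)
open import Data.List.Relation.Unary.AllPairs as AllPairs using ([]; _∷_)
open import Data.List.Relation.Unary.Any using (here; there)
open import Data.List.Relation.Unary.Linked as Linked using (Linked; []; [-]; _∷_)
open import Data.List.Relation.Unary.Unique.Propositional using (Unique)
open import Data.List.Relation.Unary.Unique.Propositional.Properties
  using (allFin⁺; map⁺; Unique[x∷xs]⇒x∉xs) renaming (filter⁺ to Unique-filter; ++⁺ to Unique-++)
open import Data.Nat using (ℕ; zero; suc; _+_; _*_; _∸_; _≤_; _<_; _≤?_; _≤ᵇ_; _<ᵇ_; _≡ᵇ_; ∣_-_∣; _⊓_; z≤n;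
    s≤s; s≤s⁻¹)
open import Data.Nat.DivMod using (m<n⇒m%n≡m; n%n≡0)
open import Data.Nat.Properties hiding (_≟_)
open import Data.Nat.Tactic.RingSolver using (solve-∀)
open import Data.Product using (Σ; ∃; ∃₂; _×_; _,_; proj₁; proj₂)
open import Data.Sum using (_⊎_; inj₁; inj₂; [_,_]′)
open import Data.Vec as Vec using (Vec; []; _∷_; replicate; zipWith)
open import Function using (_∘_; id; const)
open import Function.Bundles using (Equivalence)
open import Function.Definitions using (Injective)
open import Level using (0ℓ)
open import Relation.Binary using (Rel; Symmetric; tri<; tri≈; tri>)
open import Relation.Binary.PropositionalEquality
  using (_≡_; _≢_; refl; sym; trans; cong; cong₂; subst; subst₂; setoid; module ≡-Reasoning)
open import Relation.Nullary using (¬_; Dec; yes; no; does; ¬?; _×-dec_; _→-dec_; _⊎-dec_)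
open import Relation.Nullary.Decidable using (toSum; toWitness; dec-true; dec-false; map′)
import Relation.Unary as U

-- Two facts bound the inner vertices. The inner degrees of a cycle add up to at most 60 plus twice
-- its length; an inner vertex gives 8 and costs 2, while the outer ones pay for themselves with
-- their two neighbours on the cycle, so at most ten are inner. Conversely, the predecessors of the
-- neighbours of an end are ends of rotated paths, so at least 8 are inner. The number of passages
-- from an outer to an inner vertex is invariant under rotation; hence the lower bound on outer
-- neighbours that it implies holds at all these ends at once, which makes many blocks too
-- expensive.
--
-- All paths of one search share a last vertex, the root. It lies on the resulting cycle at most as
-- `z`, so taking the first gate as the root of the second search keeps that gate out of the second
-- set.
--
-- No optimal path is ever constructed: everything up to `many-chords` refutes `FewChords`, and
-- under the goal `⊥` a better path is refuted by recursion. The cycle itself is recovered at the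
-- end by decidability, since only finitely many vertex lists compete.

infixl 6 _⊕_
infixr 7 _⊛_

-- Linear arithmetic over the naturals by Farkas certificates.

data Linear (m : ℕ) : Set where
  var : Fin m → Linear m
  con : ℕ → Linear m
  _⊕_ : Linear m → Linear m → Linear m
  _⊛_ : ℕ → Linear m → Linear m

module _ {m : ℕ} where

  eval : Vec ℕ m → Linear m → ℕ
  eval ρ (var i) = Vec.lookup ρ i
  eval ρ (con k) = k
  eval ρ (e ⊕ f) = eval ρ e + eval ρ f
  eval ρ (k ⊛ e) = k * eval ρ e

  constant : Linear m → ℕ
  constant (var i) = 0
  constant (con k) = k
  constant (e ⊕ f) = constant e + constant f
  constant (k ⊛ e) = k * constant e

unit : ∀ {m} → Fin m → Vec ℕ m
unit {suc m} zero    = 1 ∷ replicate m 0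
unit {suc m} (suc i) = 0 ∷ unit i

coefficients : ∀ {m} → Linear m → Vec ℕ m
coefficients     (var i) = unit i
coefficients {m} (con k) = replicate m 0
coefficients     (e ⊕ f) = zipWith _+_ (coefficients e) (coefficients f)
coefficients     (k ⊛ e) = Vec.map (k *_) (coefficients e)

dot : ∀ {m} → Vec ℕ m → Vec ℕ m → ℕ
dot []      []      = 0
dot (a ∷ u) (x ∷ ρ) = a * x + dot u ρ

dot-0 : ∀ {m} (ρ : Vec ℕ m) → dot (replicate m 0) ρ ≡ 0
dot-0 []      = refl
dot-0 (x ∷ ρ) = dot-0 ρ

dot-unit : ∀ {m} (i : Fin m) ρ → dot (unit i) ρ ≡ Vec.lookup ρ i
dot-unit zero    (x ∷ ρ) rewrite dot-0 ρ | +-identityʳ x = +-identityʳ x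
dot-unit (suc i) (x ∷ ρ) = dot-unit i ρ

dot-+ : ∀ {m} (u v ρ : Vec ℕ m) → dot (zipWith _+_ u v) ρ ≡ dot u ρ + dot v ρ
dot-+ []      []      []      = refl
dot-+ (a ∷ u) (b ∷ v) (x ∷ ρ) rewrite dot-+ u v ρ = distribute a b x (dot u ρ) (dot v ρ)
  where
  distribute : ∀ a b x p q → (a + b) * x + (p + q) ≡ a * x + p + (b * x + q)
  distribute = solve-∀

dot-* : ∀ {m} k (u ρ : Vec ℕ m) → dot (Vec.map (k *_) u) ρ ≡ k * dot u ρ
dot-* k []      []      = sym (*-zeroʳ k)
dot-* k (a ∷ u) (x ∷ ρ) rewrite dot-* k u ρ = distribute k a x (dot u ρ)
  where
  distribute : ∀ k a x p → k * a * x + k * p ≡ k * (a * x + p)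
  distribute = solve-∀

eval-normal : ∀ {m} (ρ : Vec ℕ m) e → eval ρ e ≡ constant e + dot (coefficients e) ρ
eval-normal ρ (var i) = sym (dot-unit i ρ)
eval-normal ρ (con k) = sym (trans (cong (k +_) (dot-0 ρ)) (+-identityʳ k))
eval-normal ρ (e ⊕ f)
  rewrite eval-normal ρ e | eval-normal ρ f | dot-+ (coefficients e) (coefficients f) ρ =
    interchange (constant e) _ (constant f) _
  where
  interchange : ∀ a b c d → a + b + (c + d) ≡ a + c + (b + d)
  interchange = solve-∀
eval-normal ρ (k ⊛ e)
  rewrite eval-normal ρ e | dot-* k (coefficients e) ρ = *-distribˡ-+ k (constant e) _

_≤ᵛ_ : ∀ {m} → Vec ℕ m → Vec ℕ m → Bool
[]      ≤ᵛ []      = true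
(a ∷ u) ≤ᵛ (b ∷ v) = (a ≤ᵇ b) ∧ (u ≤ᵛ v)

dot-mono : ∀ {m} (u v ρ : Vec ℕ m) → T (u ≤ᵛ v) → dot u ρ ≤ dot v ρ
dot-mono []      []      []      _ = z≤n
dot-mono (a ∷ u) (b ∷ v) (x ∷ ρ) t with Equivalence.to Bool.T-∧ t
... | a≤b , u≤v = +-mono-≤ (*-monoˡ-≤ x (≤ᵇ⇒≤ a b a≤b)) (dot-mono u v ρ u≤v)

Weighted : ℕ → Set
Weighted m = ℕ × Linear m × Linear m

lhs rhs : ∀ {m} → List (Weighted m) → Linear m
lhs []                 = con 0
lhs ((k , l , r) ∷ hs) = k ⊛ l ⊕ lhs hs
rhs []                 = con 0
rhs ((k , l , r) ∷ hs) = k ⊛ r ⊕ rhs hs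

-- Comparing coefficients avoids subtraction in `ℕ`: a right side with a smaller constant and no
-- larger coefficient is smaller at every valuation.
infeasible : ∀ {m} → List (Weighted m) → Bool
infeasible hs = (constant (rhs hs) <ᵇ constant (lhs hs)) ∧ (coefficients (rhs hs) ≤ᵛ coefficients (lhs hs))

-- A Farkas certificate: the weighted sum of the hypotheses is visibly impossible.
farkas : ∀ {m} (ρ : Vec ℕ m) (hs : List (Weighted m)) → {T (infeasible hs)} →
         All (λ h → eval ρ (proj₁ (proj₂ h)) ≤ eval ρ (proj₂ (proj₂ h))) hs → ⊥
farkas ρ hs {t} ps with Equivalence.to Bool.T-∧ t
... | c< , v≤ = n≮n _ (begin-strict
  eval ρ (rhs hs)
    ≡⟨ eval-normal ρ (rhs hs) ⟩
  constant (rhs hs) + dot (coefficients (rhs hs)) ρ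
    <⟨ +-mono-<-≤ (<ᵇ⇒< _ _ c<) (dot-mono (coefficients (rhs hs)) _ ρ v≤) ⟩
  constant (lhs hs) + dot (coefficients (lhs hs)) ρ
    ≡⟨ sym (eval-normal ρ (lhs hs)) ⟩
  eval ρ (lhs hs)
    ≤⟨ add ps ⟩
  eval ρ (rhs hs) ∎)
  where
  open ≤-Reasoning
  add : ∀ {hs} → All (λ h → eval ρ (proj₁ (proj₂ h)) ≤ eval ρ (proj₂ (proj₂ h))) hs →
        eval ρ (lhs hs) ≤ eval ρ (rhs hs)
  add []                        = z≤n
  add {(k , _) ∷ _} (p ∷ ps)    = +-mono-≤ (*-monoʳ-≤ k p) (add ps)

-- Weighted sums over lists.

module _ {A : Set} where

  ∑ : List A → (A → ℕ) → ℕ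
  ∑ []      w = 0
  ∑ (x ∷ l) w = w x + ∑ l w

  ∑-mono : ∀ l {v w : A → ℕ} → (∀ x → x ∈ l → v x ≤ w x) → ∑ l v ≤ ∑ l w
  ∑-mono []      v≤w = z≤n
  ∑-mono (x ∷ l) v≤w = +-mono-≤ (v≤w x (here refl)) (∑-mono l λ y → v≤w y ∘ there)

  ∑-cong : ∀ l {v w : A → ℕ} → (∀ x → x ∈ l → v x ≡ w x) → ∑ l v ≡ ∑ l w
  ∑-cong l v≡w = ≤-antisym (∑-mono l λ x x∈l → ≤-reflexive (v≡w x x∈l))
                           (∑-mono l λ x x∈l → ≤-reflexive (sym (v≡w x x∈l)))

  ∑-+ : ∀ l (v w : A → ℕ) → ∑ l (λ x → v x + w x) ≡ ∑ l v + ∑ l w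
  ∑-+ []      v w = refl
  ∑-+ (x ∷ l) v w rewrite ∑-+ l v w = interchange (v x) (w x) (∑ l v) (∑ l w)
    where
    interchange : ∀ a b c d → a + b + (c + d) ≡ a + c + (b + d)
    interchange = solve-∀

  ∑-*ˡ : ∀ l k (w : A → ℕ) → ∑ l (λ x → k * w x) ≡ k * ∑ l w
  ∑-*ˡ []      k w = sym (*-zeroʳ k)
  ∑-*ˡ (x ∷ l) k w rewrite ∑-*ˡ l k w = sym (*-distribˡ-+ k (w x) (∑ l w))

  ∑-const : ∀ l k → ∑ l (const k) ≡ length l * k
  ∑-const []      k = refl
  ∑-const (x ∷ l) k = cong (k +_) (∑-const l k)

  ∑-0 : ∀ l {w : A → ℕ} → (∀ x → x ∈ l → w x ≡ 0) → ∑ l w ≡ 0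
  ∑-0 l w≡0 = trans (∑-cong l w≡0) (trans (∑-const l 0) (*-zeroʳ (length l)))

  ∑-++ : ∀ k l (w : A → ℕ) → ∑ (k ++ l) w ≡ ∑ k w + ∑ l w
  ∑-++ []      l w = refl
  ∑-++ (x ∷ k) l w rewrite ∑-++ k l w = sym (+-assoc (w x) _ _)

  ∑-↭ : ∀ {k l} (w : A → ℕ) → k ↭ l → ∑ k w ≡ ∑ l w
  ∑-↭ w Perm.refl         = refl
  ∑-↭ w (Perm.prep x p)   = cong (w x +_) (∑-↭ w p)
  ∑-↭ w (Perm.swap x y p) rewrite ∑-↭ w p = exchange (w x) (w y) _
    where
    exchange : ∀ a b c → a + (b + c) ≡ b + (a + c)
    exchange = solve-∀
  ∑-↭ w (Perm.trans p q)  = trans (∑-↭ w p) (∑-↭ w q)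

  term≤∑ : ∀ {l} {x} (w : A → ℕ) → x ∈ l → w x ≤ ∑ l w
  term≤∑ w (here refl) = m≤m+n _ _
  term≤∑ w (there x∈l) = ≤-trans (term≤∑ w x∈l) (m≤n+m _ _)

  -- The alternative `w x ≡ 0` lets `k` be all of `allFin n`: if `w` indicates adjacency, only the
  -- neighbours have to lie in `l`.
  ∑-⊆ : ∀ {k l} (w : A → ℕ) → Unique k → (∀ x → x ∈ k → w x ≡ 0 ⊎ x ∈ l) → ∑ k w ≤ ∑ l w
  ∑-⊆ {[]}    w _         _ = z≤n
  ∑-⊆ {x ∷ k} {l} w (x≢ ∷ uk) sub with sub x (here refl)
  ... | inj₁ wx≡0 rewrite wx≡0 = ∑-⊆ w uk (λ y → sub y ∘ there)
  ... | inj₂ x∈l with ∈-∃++ x∈l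
  ...   | l₁ , l₂ , refl = begin
    w x + ∑ k w            ≤⟨ +-monoʳ-≤ (w x) (∑-⊆ w uk sub′) ⟩
    w x + ∑ (l₁ ++ l₂) w   ≡⟨ sym (∑-↭ w (shift x l₁ l₂)) ⟩
    ∑ (l₁ ++ x ∷ l₂) w     ∎
    where
    open ≤-Reasoning
    sub′ : ∀ y → y ∈ k → w y ≡ 0 ⊎ y ∈ l₁ ++ l₂
    sub′ y y∈k with sub y (there y∈k)
    ... | inj₁ e = inj₁ e
    ... | inj₂ y∈l with ∈-resp-↭ (shift x l₁ l₂) y∈l
    ...   | here refl = ⊥-elim (All.lookup x≢ y∈k refl)
    ...   | there y∈  = inj₂ y∈

  ⊆⇒length≤ : ∀ {k l : List A} → Unique k → (∀ x → x ∈ k → x ∈ l) → length k ≤ length l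
  ⊆⇒length≤ {k} {l} uk sub = subst₂ _≤_ (one k) (one l) (∑-⊆ (const 1) uk λ x → inj₂ ∘ sub x)
    where
    one : ∀ m → ∑ m (const 1) ≡ length m
    one m = trans (∑-const m 1) (*-identityʳ _)

∑-swap : ∀ {A B : Set} (k : List A) (l : List B) (w : A → B → ℕ) →
         ∑ k (λ x → ∑ l (w x)) ≡ ∑ l (λ y → ∑ k (λ x → w x y))
∑-swap []      l w = sym (∑-0 l λ _ _ → refl)
∑-swap (x ∷ k) l w = trans (cong (∑ l (w x) +_) (∑-swap k l w)) (sym (∑-+ l (w x) _))

module _ {A : Set} where

  -- Both directions of each step are counted, for comparison with sums over ordered pairs.
  consecutive-sum : (A → A → ℕ) → List A → ℕ
  consecutive-sum F (u ∷ v ∷ l) = F u v + F v u + consecutive-sum F (v ∷ l)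
  consecutive-sum F _           = 0

  -- Splitting off the head `u` splits off its row and its column, and the first step contributes
  -- one entry of each.
  consecutive-sum≤ : ∀ F l → consecutive-sum F l ≤ ∑ l (λ u → ∑ l (F u))
  consecutive-sum≤ F []          = z≤n
  consecutive-sum≤ F (u ∷ [])    = z≤n
  consecutive-sum≤ F (u ∷ m@(v ∷ l)) = begin
    F u v + F v u + consecutive-sum F m
      ≤⟨ +-monoʳ-≤ (F u v + F v u) (consecutive-sum≤ F m) ⟩
    F u v + F v u + ∑ m (λ x → ∑ m (F x))
      ≤⟨ +-monoˡ-≤ _ (+-mono-≤ (term≤∑ {l = m} (F u) (here refl)) (term≤∑ {l = m} (λ x → F x u) (here refl))) ⟩
    ∑ m (F u) + ∑ m (λ x → F x u) + ∑ m (λ x → ∑ m (F x))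
      ≡⟨ trans (+-assoc (∑ m (F u)) _ _) (cong (∑ m (F u) +_) (sym (∑-+ m (λ x → F x u) _))) ⟩
    ∑ m (F u) + ∑ m (λ x → F x u + ∑ m (F x))
      ≤⟨ +-monoˡ-≤ _ (m≤n+m _ (F u u)) ⟩
    F u u + ∑ m (F u) + ∑ m (λ x → F x u + ∑ m (F x)) ∎
    where
    open ≤-Reasoning

⟦_⟧ : Bool → ℕ
⟦ true  ⟧ = 1
⟦ false ⟧ = 0

⟦⟧≤1 : ∀ b → ⟦ b ⟧ ≤ 1
⟦⟧≤1 true  = ≤-refl
⟦⟧≤1 false = z≤n

-- Lists as paths: last elements, uniqueness, reversal.

module _ {A : Set} where

  lastOr : A → List A → A
  lastOr d []      = d
  lastOr d (x ∷ l) = lastOr x l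

  lastOr-++ : ∀ {d} l {x m} → lastOr d (l ++ x ∷ m) ≡ lastOr x m
  lastOr-++ []      = refl
  lastOr-++ (y ∷ l) = lastOr-++ l

  lastOr-ʳ++ : ∀ {d} l {x m} → lastOr d (l ʳ++ x ∷ m) ≡ lastOr x m
  lastOr-ʳ++ []      = refl
  lastOr-ʳ++ {d} (y ∷ l) = lastOr-ʳ++ {d} l

  lastOr-∈ : ∀ x l → lastOr x l ∈ x ∷ l
  lastOr-∈ x []      = here refl
  lastOr-∈ x (y ∷ l) = there (lastOr-∈ y l)

  Unique-resp-↭ : ∀ {k l : List A} → k ↭ l → Unique k → Unique l
  Unique-resp-↭ p = SetoidPerm.Unique-resp-↭ (setoid A) (↭⇒↭ₛ p)

  Unique-++⁻ʳ : ∀ k {l : List A} → Unique (k ++ l) → Unique l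
  Unique-++⁻ʳ []      u       = u
  Unique-++⁻ʳ (x ∷ k) (_ ∷ u) = Unique-++⁻ʳ k u

  Unique-++⁻ˡ : ∀ k {l : List A} → Unique (k ++ l) → Unique k
  Unique-++⁻ˡ []      u       = []
  Unique-++⁻ˡ (x ∷ k) {l} (x≢ ∷ u) =
    All.tabulate (λ y∈k → All.lookup x≢ (∈-++⁺ˡ y∈k)) ∷ Unique-++⁻ˡ k u

  Unique-++-disjoint : ∀ k {l : List A} → Unique (k ++ l) → ∀ {v} → v ∈ k → v ∈ l → ⊥
  Unique-++-disjoint (x ∷ k) (x≢ ∷ u) (here refl) v∈l = All.lookup x≢ (∈-++⁺ʳ k v∈l) refl
  Unique-++-disjoint (x ∷ k) (_ ∷ u)  (there v∈k) v∈l = Unique-++-disjoint k u v∈k v∈l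

module _ {A : Set} {R : Rel A 0ℓ} where

  Linked-++ : ∀ {x l m} → Linked R (x ∷ l) → Linked R (lastOr x l ∷ m) → Linked R (x ∷ l ++ m)
  Linked-++ [-]      q = q
  Linked-++ (r ∷ p)  q = r ∷ Linked-++ p q

  Linked-++⁻ʳ : ∀ l {m} → Linked R (l ++ m) → Linked R m
  Linked-++⁻ʳ []      p = p
  Linked-++⁻ʳ (x ∷ l) p = Linked-++⁻ʳ l (Linked.tail p)

  Linked-++⁻ˡ : ∀ l {x m} → Linked R (l ++ x ∷ m) → Linked R (l ++ [ x ])
  Linked-++⁻ˡ []          p       = [-]
  Linked-++⁻ˡ (y ∷ [])    (r ∷ p) = r ∷ [-]
  Linked-++⁻ˡ (y ∷ w ∷ l) (r ∷ p) = r ∷ Linked-++⁻ˡ (w ∷ l) p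

  Linked-ʳ++ : Symmetric R → ∀ {u} l {m} → Linked R (u ∷ l) → Linked R (u ∷ m) → Linked R (l ʳ++ (u ∷ m))
  Linked-ʳ++ R-sym []      p       q = q
  Linked-ʳ++ R-sym (w ∷ l) (r ∷ p) q = Linked-ʳ++ R-sym l p (R-sym r ∷ q)

module _ {n : ℕ} where

  indicator : Fin n → Fin n → ℕ
  indicator x u = ⟦ does (x ≟ u) ⟧

  indicator-refl : ∀ x → indicator x x ≡ 1
  indicator-refl x with x ≟ x
  ... | yes _ = refl
  ... | no ¬p = ⊥-elim (¬p refl)

  indicator-≢ : ∀ {x u} → x ≢ u → indicator x u ≡ 0
  indicator-≢ {x} {u} x≢u with x ≟ u
  ... | yes p = ⊥-elim (x≢u p)
  ... | no _  = refl

  1≤∑indicator : ∀ {x l} → x ∈ l → 1 ≤ ∑ l (indicator x)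
  1≤∑indicator {x} x∈l = ≤-trans (≤-reflexive (sym (indicator-refl x))) (term≤∑ (indicator x) x∈l)

  Unique⇒length≤ : ∀ {l : List (Fin n)} → Unique l → length l ≤ n
  Unique⇒length≤ {l} u = ≤-trans (⊆⇒length≤ u λ x _ → ∈-allFin x) (≤-reflexive (length-tabulate id))

module _ {n : ℕ} where
  open import Data.List.Membership.DecPropositional (_≟_ {n}) public using (_∈?_)

-- Boolean adjacency, cycles as lists, and rotation.

-- Boolean values can be summed, and edges are deleted by a conjunction.
record Adjacency (n : ℕ) : Set where
  field
    adj     : Fin n → Fin n → Bool
    adj-sym : ∀ u v → adj u v ≡ adj v u
    adj-irr : ∀ v → adj v v ≡ false

  infix 4 _∼_ _∼?_
  _∼_ : Fin n → Fin n → Set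
  u ∼ v = adj u v ≡ true

  _∼?_ : ∀ u v → Dec (u ∼ v)
  u ∼? v = adj u v Bool.≟ true

  ∼-sym : Symmetric _∼_
  ∼-sym {u} {v} u∼v = trans (adj-sym v u) u∼v

  ∼-irr : ∀ {v} → ¬ v ∼ v
  ∼-irr {v} v∼v with trans (sym v∼v) (adj-irr v)
  ... | ()

  ∼⇒≢ : ∀ {u v} → u ∼ v → u ≢ v
  ∼⇒≢ u∼v refl = ∼-irr u∼v

  ∣_∼∣ : Fin n → Fin n → ℕ
  ∣ u ∼∣ v = ⟦ adj u v ⟧

  ∣∼∣-yes : ∀ {u v} → u ∼ v → ∣ u ∼∣ v ≡ 1
  ∣∼∣-yes = cong ⟦_⟧

  ∣∼∣-no : ∀ {u v} → ¬ u ∼ v → ∣ u ∼∣ v ≡ 0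
  ∣∼∣-no ¬uv = cong ⟦_⟧ (Bool.¬-not ¬uv)

  ∣∼∣-sym : ∀ u v → ∣ u ∼∣ v ≡ ∣ v ∼∣ u
  ∣∼∣-sym u v = cong ⟦_⟧ (adj-sym u v)

  degree : Fin n → ℕ
  degree v = ∑ (allFin n) ∣ v ∼∣

  degree-within : List (Fin n) → Fin n → ℕ
  degree-within l v = ∑ l ∣ v ∼∣

  degree≤within : ∀ {v l} → (∀ u → v ∼ u → u ∈ l) → degree v ≤ degree-within l v
  degree≤within {v} {l} sub = ∑-⊆ ∣ v ∼∣ (allFin⁺ n) λ u _ → case u
    where
    case : ∀ u → ∣ v ∼∣ u ≡ 0 ⊎ u ∈ l
    case u with v ∼? u
    ... | yes v∼u = inj₂ (sub u v∼u)
    ... | no ¬vu  = inj₁ (∣∼∣-no ¬vu)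

  within≤degree : ∀ {v l} → Unique l → degree-within l v ≤ degree v
  within≤degree {v} ul = ∑-⊆ ∣ v ∼∣ ul λ u _ → inj₂ (∈-allFin u)

  record IsCycle (x : Fin n) (c : List (Fin n)) : Set where
    field
      linked  : Linked _∼_ (x ∷ c)
      unique  : Unique (x ∷ c)
      closing : x ∼ lastOr x c
      long    : 3 ≤ length (x ∷ c)

  -- In a cycle on the list l the number of chords is half the sum of the inner degrees, minus
  -- length l; so FewChords says that no cycle has more than 30 chords.
  FewChords : Set
  FewChords = ∀ {x c} → IsCycle x c → ∑ (x ∷ c) (degree-within (x ∷ c)) ≤ 60 + 2 * length (x ∷ c)

  record Traversal (c : List (Fin n)) (z : Fin n) (p : List (Fin n)) : Set where
    field
      perm   : p ↭ c
      linked : Linked _∼_ p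
      -- `lastOr` needs a default; for a nonempty `c` it is never taken.
      end    : lastOr z p ≡ z

  ClosedEnds : Fin n → List (Fin n) → Set
  ClosedEnds x c = ∀ {y q} → Traversal (x ∷ c) (lastOr x c) (y ∷ q) → ∀ u → y ∼ u → u ∈ x ∷ c

  -- The edge from `a` to `h` is exchanged for the one from `x` to `h`, which reverses the part
  -- before `h`. For empty `l`, `a` is `x` and the path stays the same.
  rotate : ∀ {c z x q} l {a h m} → Traversal c z (x ∷ q) → x ∷ q ≡ l ++ a ∷ h ∷ m → x ∼ h →
           Traversal c z (a ∷ (l ʳ++ h ∷ m))
  rotate []      T refl x∼h = T
  rotate {c} {z} (x ∷ l) {a} {h} {m} T refl x∼h = record
    { perm   = subst (_↭ c) reversed
                 (↭-trans (↭-sym (++↭ʳ++ front (h ∷ m))) (subst (_↭ c) regroup perm))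
    ; linked = subst (Linked _∼_) reversed
                 (Linked-ʳ++ ∼-sym (l ++ [ a ]) (Linked-++⁻ˡ (x ∷ l) linked)
                   (x∼h ∷ Linked-++⁻ʳ front (subst (Linked _∼_) regroup linked)))
    ; end    = trans (lastOr-ʳ++ {d = a} (x ∷ l))
                 (trans (sym (lastOr-++ {d = z} front)) (trans (cong (lastOr z) (sym regroup)) end))
    }
    where
    open Traversal T
    front = x ∷ l ++ [ a ]
    regroup : x ∷ l ++ a ∷ h ∷ m ≡ front ++ h ∷ m
    regroup = sym (++-assoc (x ∷ l) [ a ] (h ∷ m))
    reversed : front ʳ++ (h ∷ m) ≡ a ∷ ((x ∷ l) ʳ++ h ∷ m)
    reversed = ++-ʳ++ (x ∷ l)

-- Pósa rotation on a cycle with closed ends.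

module _ {A : Set} where

  ʳ++-++ : ∀ (k : List A) {l m} → (k ʳ++ l) ++ m ≡ k ʳ++ (l ++ m)
  ʳ++-++ []      = refl
  ʳ++-++ (x ∷ k) = ʳ++-++ k

  split-last : ∀ (x : A) h m → ∃₂ λ l a → x ∷ h ∷ m ≡ l ++ a ∷ lastOr h m ∷ []
  split-last x h []      = [] , x , refl
  split-last x h (i ∷ m) with split-last h i m
  ... | l , a , eq = x ∷ l , a , cong (x ∷_) eq

  second-∈-tail : ∀ {x : A} {q} l {a h m} → x ∷ q ≡ l ++ a ∷ h ∷ m → h ∈ q
  second-∈-tail []      refl = here refl
  second-∈-tail (_ ∷ l) refl = ∈-++⁺ʳ l (there (here refl))

-- The degree bounds give `δa + δb ≥ 16 - S`, the block bounds `X + Y ≥ (10 - S) * (S - 3)`. The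
-- total exceeds `64 - 6 * S` for 8, 9 and 10; being quadratic in `S`, it needs a certificate for
-- each value.
final-count : ∀ S f α β δa δb X Y → 8 ≤ S → S ≤ 10 → S ≡ α + β + 2 → 8 ≤ α + 1 + δa → 8 ≤ 1 + β + δb →
              (10 ∸ S) * α ≤ X → (10 ∸ S) * β ≤ Y + (10 ∸ S) → X + δa + δb + Y ≤ f → 6 * S + f ≤ 64 → ⊥
final-count S f α β δa δb X Y 8≤S S≤10 S≡ a≥ b≥ X≥ Y≥ f≥ f≤ with m≤n⇒∃[o]m+o≡n 8≤S
... | 0 , refl = farkas (α ∷ β ∷ δa ∷ δb ∷ X ∷ Y ∷ f ∷ [])
  ( (3 , con 8 , vα ⊕ vβ ⊕ con 2)
  ∷ (1 , con 8 , vα ⊕ con 1 ⊕ va) ∷ (1 , con 8 , con 1 ⊕ vβ ⊕ vb)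
  ∷ (1 , 2 ⊛ vα , vX) ∷ (1 , 2 ⊛ vβ , vY ⊕ con 2)
  ∷ (1 , vX ⊕ va ⊕ vb ⊕ vY , vf) ∷ (1 , con 48 ⊕ vf , con 64)
  ∷ (2 , vα ⊕ vβ ⊕ con 2 , con 8) ∷ [])
  (≤-reflexive S≡ ∷ a≥ ∷ b≥ ∷ X≥ ∷ Y≥ ∷ f≥ ∷ f≤ ∷ ≤-reflexive (sym S≡) ∷ [])
  where
  vα = var (# 0) ; vβ = var (# 1) ; va = var (# 2) ; vb = var (# 3) ; vX = var (# 4) ; vY = var (# 5) ; vf =
      var (# 6)
... | 1 , refl = farkas (α ∷ β ∷ δa ∷ δb ∷ X ∷ Y ∷ f ∷ [])
  ( (1 , con 8 , vα ⊕ con 1 ⊕ va) ∷ (1 , con 8 , con 1 ⊕ vβ ⊕ vb)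
  ∷ (1 , 1 ⊛ vα , vX) ∷ (1 , 1 ⊛ vβ , vY ⊕ con 1)
  ∷ (1 , vX ⊕ va ⊕ vb ⊕ vY , vf) ∷ (1 , con 54 ⊕ vf , con 64) ∷ [])
  (a≥ ∷ b≥ ∷ X≥ ∷ Y≥ ∷ f≥ ∷ f≤ ∷ [])
  where
  vα = var (# 0) ; vβ = var (# 1) ; va = var (# 2) ; vb = var (# 3) ; vX = var (# 4) ; vY = var (# 5) ; vf =
      var (# 6)
... | 2 , refl = farkas (α ∷ β ∷ δa ∷ δb ∷ X ∷ Y ∷ f ∷ [])
  ( (1 , con 8 , vα ⊕ con 1 ⊕ va) ∷ (1 , con 8 , con 1 ⊕ vβ ⊕ vb)
  ∷ (1 , vX ⊕ va ⊕ vb ⊕ vY , vf) ∷ (1 , con 60 ⊕ vf , con 64)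
  ∷ (1 , vα ⊕ vβ ⊕ con 2 , con 10) ∷ [])
  (a≥ ∷ b≥ ∷ f≥ ∷ f≤ ∷ ≤-reflexive (sym S≡) ∷ [])
  where
  vα = var (# 0) ; vβ = var (# 1) ; va = var (# 2) ; vb = var (# 3) ; vX = var (# 4) ; vY = var (# 5) ; vf =
      var (# 6)
... | suc (suc (suc k)) , refl = m+1+n≰m 10 S≤10

-- Pósa rotation on a cycle c through z such that every Hamiltonian path of c ending in z starts
-- in a vertex all of whose neighbours lie on c.  Vertices other than z with all their neighbours
-- on c are called inner.
module Pocket {n : ℕ} (A : Adjacency n) (few : Adjacency.FewChords A) {x₀ : Fin n} {c₀ : List (Fin n)}
  (cyc : Adjacency.IsCycle A x₀ c₀) (closed-ends : Adjacency.ClosedEnds A x₀ c₀)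
  where

  open Adjacency A
  open IsCycle cyc

  c = x₀ ∷ c₀
  z = lastOr x₀ c₀

  Trav : List (Fin n) → Set
  Trav = Traversal c z

  Inner : Fin n → Set
  Inner v = v ≢ z × (∀ u → v ∼ u → u ∈ c)

  -- Opaque, so that the decision over all of `Fin n` does not unfold inside `s` and `t`.
  abstract
    inner? : ∀ v → Dec (Inner v)
    inner? v = ¬? (v ≟ z) ×-dec all? (λ u → (v ∼? u) →-dec (u ∈? c))

  -- Indicators of the inner and the outer vertices; below, ds and dt count the neighbours of either
  -- kind on c, and f is the number of edges between the two kinds.
  s t : Fin n → ℕ
  s v = ⟦ does (inner? v) ⟧
  t v = ⟦ not (does (inner? v)) ⟧

  s-inner : ∀ {v} → Inner v → s v ≡ 1
  s-inner {v} i with inner? v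
  ... | yes _ = refl
  ... | no ¬i = ⊥-elim (¬i i)

  s-outer : ∀ {v} → ¬ Inner v → s v ≡ 0
  s-outer {v} ¬i with inner? v
  ... | yes i = ⊥-elim (¬i i)
  ... | no _  = refl

  t-inner : ∀ {v} → Inner v → t v ≡ 0
  t-inner {v} i with inner? v
  ... | yes _ = refl
  ... | no ¬i = ⊥-elim (¬i i)

  t-outer : ∀ {v} → ¬ Inner v → t v ≡ 1
  t-outer {v} ¬i with inner? v
  ... | yes i = ⊥-elim (¬i i)
  ... | no _  = refl

  s≤1 : ∀ v → s v ≤ 1
  s≤1 v = ⟦⟧≤1 (does (inner? v))

  s+t : ∀ v → s v + t v ≡ 1
  s+t v with inner? v
  ... | yes _ = refl
  ... | no _  = refl

  z-outer : ¬ Inner z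
  z-outer (z≢z , _) = z≢z refl

  trav-unique : ∀ {p} → Trav p → Unique p
  trav-unique T = Unique-resp-↭ (↭-sym (Traversal.perm T)) unique

  full : Trav c
  full = record { perm = ↭-refl ; linked = linked ; end = refl }

  -- Every traversal ends in `z` and has at least three vertices, so it cannot also start there.
  end-inner : ∀ {y q} → Trav (y ∷ q) → Inner y
  end-inner {y} {[]} T with ↭-length (Traversal.perm T) | long
  ... | eq | s≤s le = ⊥-elim (n≮0 (≤-trans (≤-trans (s≤s z≤n) le) (≤-reflexive (sym (suc-injective eq)))))
  end-inner {y} {h ∷ m} T = y≢z , closed-ends T
    where
    y≢z : y ≢ z
    y≢z refl with trav-unique T
    ... | y≢ ∷ _ = All.lookup y≢ (lastOr-∈ h m) (sym (Traversal.end T))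

  -- Otherwise a rotation would make `a` an end, hence inner.
  nonadjacent : ∀ {x q} l {a h m} → Trav (x ∷ q) → x ∷ q ≡ l ++ a ∷ h ∷ m → ¬ Inner a → ¬ x ∼ h
  nonadjacent l T eq ¬i x∼h = ¬i (end-inner (rotate l T eq x∼h))

  -- heads counts the inner vertices preceded by an outer one, joints the outer ones preceded by an
  -- outer one; a rotation preserves both, as its old and new ends are inner.
  heads joints : List (Fin n) → ℕ
  heads (y ∷ h ∷ l)  = t y * s h + heads (h ∷ l)
  heads _            = 0
  joints (y ∷ h ∷ l) = t y * t h + joints (h ∷ l)
  joints _           = 0

  -- Every outer vertex except a final one is followed either by an inner or by an outer vertex.
  heads+joints : ∀ y l → heads (y ∷ l) + joints (y ∷ l) + t (lastOr y l) ≡ ∑ (y ∷ l) t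
  heads+joints y []      = sym (+-identityʳ (t y))
  heads+joints y (h ∷ l) = trans (regroup (t y * s h) _ (t y * t h) _ _)
    (cong₂ _+_ (trans (sym (*-distribˡ-+ (t y) (s h) (t h)))
        (trans (cong (t y *_) (s+t h)) (*-identityʳ (t y))))
               (heads+joints h l))
    where
    regroup : ∀ a p b q r → a + p + (b + q) + r ≡ a + b + (p + q + r)
    regroup = solve-∀

  joints-++ : ∀ l {x m} → joints (l ++ x ∷ m) ≡ joints (l ++ [ x ]) + joints (x ∷ m)
  joints-++ []              = refl
  joints-++ (y ∷ []) {x} {m} = cong (_+ joints (x ∷ m)) (sym (+-identityʳ (t y * t x)))
  joints-++ (y ∷ w ∷ l)     = trans (cong (t y * t w +_) (joints-++ (w ∷ l))) (sym (+-assoc (t y * t w) _ _))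

  joints-ʳ++ : ∀ u l {m} → joints (l ʳ++ (u ∷ m)) ≡ joints (u ∷ l) + joints (u ∷ m)
  joints-ʳ++ u []      = refl
  joints-ʳ++ u (w ∷ l) {m} = trans (joints-ʳ++ w l) (regroup (joints (w ∷ l)) (t w) (t u) _)
    where
    regroup : ∀ a p q b → a + (p * q + b) ≡ q * p + a + b
    regroup = solve-∀

  S T# : ℕ
  S  = ∑ c s
  T# = ∑ c t

  trav-heads : ∀ {x q} → Trav (x ∷ q) → heads (x ∷ q) + joints (x ∷ q) + 1 ≡ T#
  trav-heads {x} {q} T = trans
    (cong (heads (x ∷ q) + joints (x ∷ q) +_) (sym (trans (cong t end) (t-outer z-outer))))
    (trans (heads+joints x q) (∑-↭ t perm))
    where open Traversal T

  rotate-joints : ∀ {x q} l {a h m} → Trav (x ∷ q) → x ∷ q ≡ l ++ a ∷ h ∷ m → x ∼ h →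
                  joints (a ∷ (l ʳ++ h ∷ m)) ≡ joints (x ∷ q)
  rotate-joints []      T refl x∼h = refl
  rotate-joints (x ∷ l) {a} {h} {m} T refl x∼h =
    trans (cong joints (sym (++-ʳ++ (x ∷ l) {[ a ]})))
    (trans (joints-ʳ++ x (l ++ [ a ]))
    -- The lost pair starts in `a`, the new one in `x`; both are inner, so neither is a joint.
    (trans (cong (λ i → joints (x ∷ l ++ [ a ]) + (i * t h + joints (h ∷ m)))
             (trans (t-inner (end-inner T)) (sym (t-inner (end-inner (rotate (x ∷ l) T refl x∼h))))))
    (sym (joints-++ (x ∷ l)))))

  -- Heads depend on the direction of reading, so the reversal is not followed directly; instead,
  -- heads and joints together always number `T# - 1`.
  rotate-heads : ∀ {x q} l {a h m} → Trav (x ∷ q) → x ∷ q ≡ l ++ a ∷ h ∷ m → x ∼ h →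
                 heads (a ∷ (l ʳ++ h ∷ m)) ≡ heads (x ∷ q)
  rotate-heads {x} {q} l T eq x∼h = +-cancelʳ-≡ _ _ _ (+-cancelʳ-≡ 1 _ _
    (trans (trav-heads (rotate l T eq x∼h))
      (trans (sym (trav-heads T)) (cong (λ j → heads (x ∷ q) + j + 1) (sym (rotate-joints l T eq x∼h))))))

  dc ds dt : Fin n → ℕ
  dc v = degree-within c v
  ds v = ∑ c λ u → s u * ∣ v ∼∣ u
  dt v = ∑ c λ u → t u * ∣ v ∼∣ u

  dc-split : ∀ v → dc v ≡ ds v + dt v
  dc-split v = trans (∑-cong c λ u _ → sym (trans (sym (*-distribʳ-+ (∣ v ∼∣ u) (s u) (t u)))
                                       (trans (cong (_* ∣ v ∼∣ u) (s+t u)) (*-identityˡ _))))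
                     (∑-+ c (λ u → s u * ∣ v ∼∣ u) (λ u → t u * ∣ v ∼∣ u))

  inner-degree : ∀ {v} → Inner v → degree v ≤ dc v
  inner-degree (_ , closed) = degree≤within closed

  -- An inner vertex preceded by an outer one is no neighbour of `x`, so nothing is counted twice.
  heads-bound : ∀ x y l → (∀ l₁ {a h m} → y ∷ l ≡ l₁ ++ a ∷ h ∷ m → ¬ Inner a → ¬ x ∼ h) →
                ∑ l (λ u → s u * ∣ x ∼∣ u) + heads (y ∷ l) ≤ ∑ l s
  heads-bound x y []      non = z≤n
  heads-bound x y (h ∷ l) non = begin
    s h * ∣ x ∼∣ h + X + (t y * s h + H)   ≡⟨ regroup (s h * ∣ x ∼∣ h) X (t y * s h) H ⟩
    s h * ∣ x ∼∣ h + t y * s h + (X + H)   ≤⟨ +-mono-≤ local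
        (heads-bound x h l λ l₁ → non (y ∷ l₁) ∘ cong (y ∷_)) ⟩
    s h + ∑ l s                            ∎
    where
    open ≤-Reasoning
    X = ∑ l (λ u → s u * ∣ x ∼∣ u)
    H = heads (h ∷ l)
    regroup : ∀ a p b q → a + p + (b + q) ≡ a + b + (p + q)
    regroup = solve-∀
    local : s h * ∣ x ∼∣ h + t y * s h ≤ s h
    local with inner? y
    ... | yes _ = ≤-trans (≤-reflexive (+-identityʳ _))
        (≤-trans (*-monoʳ-≤ (s h) (⟦⟧≤1 (adj x h))) (≤-reflexive (*-identityʳ (s h))))
    ... | no ¬i rewrite ∣∼∣-no (non [] refl ¬i) | *-zeroʳ (s h) = ≤-reflexive (+-identityʳ (s h))

  -- Different positions on the path have different predecessors, so each neighbour of `x`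
  -- contributes its own `L`.
  preds-bound : ∀ x L w y l → (∀ l₁ {a h m} → y ∷ l ≡ l₁ ++ a ∷ h ∷ m → x ∼ h → L ≤ w a) →
                ∑ l ∣ x ∼∣ * L ≤ ∑ (y ∷ l) w
  preds-bound x L w y []      bound = z≤n
  preds-bound x L w y (h ∷ l) bound = begin
    (∣ x ∼∣ h + ∑ l ∣ x ∼∣) * L      ≡⟨ *-distribʳ-+ L (∣ x ∼∣ h) _ ⟩
    ∣ x ∼∣ h * L + ∑ l ∣ x ∼∣ * L    ≤⟨ +-mono-≤ local
        (preds-bound x L w h l λ l₁ → bound (y ∷ l₁) ∘ cong (y ∷_)) ⟩
    w y + ∑ (h ∷ l) w                ∎
    where
    open ≤-Reasoning
    local : ∣ x ∼∣ h * L ≤ w y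
    local with x ∼? h
    ... | yes x∼h rewrite ∣∼∣-yes x∼h | +-identityʳ L = bound [] refl x∼h
    ... | no ¬xh  rewrite ∣∼∣-no ¬xh = z≤n

  trav-degree : ∀ {x q} → Trav (x ∷ q) → degree x ≤ ∑ q ∣ x ∼∣
  trav-degree {x} {q} T = ≤-trans (inner-degree (end-inner T)) (≤-reflexive
    (trans (sym (∑-↭ ∣ x ∼∣ (Traversal.perm T))) (cong (_+ ∑ q ∣ x ∼∣) (∣∼∣-no ∼-irr))))

  -- The predecessors of the neighbours of an end are ends of rotated paths.
  end-degree≤S : ∀ {x q} → Trav (x ∷ q) → degree x ≤ S
  end-degree≤S {x} {q} T = begin
    degree x            ≤⟨ trav-degree T ⟩
    ∑ q ∣ x ∼∣          ≡⟨ sym (*-identityʳ _) ⟩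
    ∑ q ∣ x ∼∣ * 1      ≤⟨ preds-bound x 1 s x q
        (λ l eq x∼h → ≤-reflexive (sym (s-inner (end-inner (rotate l T eq x∼h))))) ⟩
    ∑ (x ∷ q) s         ≡⟨ ∑-↭ s (Traversal.perm T) ⟩
    S                   ∎
    where open ≤-Reasoning

  -- The inner neighbours of `x`, the inner vertices counted by `heads` and `x` itself are all
  -- different.
  end-ds : ∀ {x q} → Trav (x ∷ q) → ds x + heads (x ∷ q) + 1 ≤ S
  end-ds {x} {q} T = begin
    ds x + heads (x ∷ q) + 1
      ≡⟨ cong (λ d → d + heads (x ∷ q) + 1) (trans (sym (∑-↭ (λ u → s u * ∣ x ∼∣ u) (Traversal.perm T)))
           (cong (_+ X) (trans (cong (s x *_) (∣∼∣-no ∼-irr)) (*-zeroʳ (s x))))) ⟩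
    X + heads (x ∷ q) + 1
      ≤⟨ +-monoˡ-≤ 1 (heads-bound x x q λ l eq → nonadjacent l T eq) ⟩
    ∑ q s + 1
      ≡⟨ trans (+-comm _ 1) (cong (_+ ∑ q s) (sym (s-inner (end-inner T)))) ⟩
    ∑ (x ∷ q) s
      ≡⟨ ∑-↭ s (Traversal.perm T) ⟩
    S ∎
    where
    open ≤-Reasoning
    X = ∑ q (λ u → s u * ∣ x ∼∣ u)

  f outer-sum : ℕ
  f         = ∑ c λ u → s u * dt u
  outer-sum = ∑ c λ u → t u * dc u

  length-c : length c ≡ S + T#
  length-c = trans (sym (trans (∑-const c 1) (*-identityʳ _)))
             (trans (sym (∑-cong c λ u _ → s+t u)) (∑-+ c s t))

  -- Double counting of the edges between outer and inner vertices.
  t-ds : ∑ c (λ u → t u * ds u) ≡ f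
  t-ds = trans (∑-cong c λ u _ → sym (∑-*ˡ c (t u) (λ v → s v * ∣ u ∼∣ v)))
         (trans (∑-swap c c λ u v → t u * (s v * ∣ u ∼∣ v))
         (∑-cong c λ v _ → trans (∑-cong c λ u _ → exchange u v) (∑-*ˡ c (s v) (λ u → t u * ∣ v ∼∣ u))))
    where
    exchange : ∀ u v → t u * (s v * ∣ u ∼∣ v) ≡ s v * (t u * ∣ v ∼∣ u)
    exchange u v rewrite ∣∼∣-sym u v = rearrange (t u) (s v) (∣ v ∼∣ u)
      where
      rearrange : ∀ a b x → a * (b * x) ≡ b * (a * x)
      rearrange = solve-∀

  outer-split : outer-sum ≡ f + ∑ c (λ u → t u * dt u)
  outer-split = trans (∑-cong c λ u _ → trans (cong (t u *_) (dc-split u)) (*-distribˡ-+ (t u) (ds u) (dt u)))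
                (trans (∑-+ c (λ u → t u * ds u) (λ u → t u * dt u)) (cong (_+ ∑ c (λ u → t u * dt u)) t-ds))

  -- An outer vertex has two neighbours along the path; `t y` and `t (lastOr y l)` make up for the
  -- one missing at either end.
  consecutive-outer : ∀ {y l} → Linked _∼_ (y ∷ l) →
    consecutive-sum (λ u v → t u * ∣ u ∼∣ v) (y ∷ l) + t y + t (lastOr y l) ≡ 2 * ∑ (y ∷ l) t
  consecutive-outer {y} [-] = double (t y)
    where
    double : ∀ a → a + a ≡ 2 * (a + 0)
    double = solve-∀
  consecutive-outer {y} {h ∷ l} (y∼h ∷ p) rewrite ∣∼∣-yes y∼h | ∣∼∣-yes (∼-sym y∼h) =
    trans (regroup (t y) (t h) _ _)
        (trans (cong (2 * t y +_) (consecutive-outer p)) (sym (*-distribˡ-+ 2 (t y) _)))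
    where
    regroup : ∀ a b k e → a * 1 + b * 1 + k + a + e ≡ 2 * a + (k + b + e)
    regroup = solve-∀

  consecutive-joints : ∀ {l} → Linked _∼_ l → consecutive-sum (λ u v → t u * (t v * ∣ u ∼∣ v)) l ≡ 2 * joints l
  consecutive-joints []  = refl
  consecutive-joints [-] = refl
  consecutive-joints {y ∷ h ∷ l} (y∼h ∷ p) rewrite ∣∼∣-yes y∼h | ∣∼∣-yes (∼-sym y∼h) | consecutive-joints p =
    regroup (t y) (t h) (joints (h ∷ l))
    where
    regroup : ∀ a b k → a * (b * 1) + b * (a * 1) + 2 * k ≡ 2 * (a * b + k)
    regroup = solve-∀

  consecutive-sum≤c : ∀ F {p} → Trav p → consecutive-sum F p ≤ ∑ c (λ u → ∑ c (F u))
  consecutive-sum≤c F {p} T = ≤-trans (consecutive-sum≤ F p)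
    (≤-reflexive (trans (∑-cong p λ u _ → ∑-↭ (F u) perm) (∑-↭ (λ u → ∑ c (F u)) perm)))
    where open Traversal T

  -- The start is inner, so only `z` lacks a neighbour along the path; hence the 1.
  2T#≤outer-sum : 2 * T# ≤ outer-sum + 1
  2T#≤outer-sum = begin
    2 * T#                                       ≡⟨ sym (consecutive-outer linked) ⟩
    consecutive-sum F c + t x₀ + t z             ≡⟨ cong₂ (λ a b → consecutive-sum F c + a + b)
                                                      (t-inner (end-inner full)) (t-outer z-outer) ⟩
    consecutive-sum F c + 0 + 1                  ≡⟨ cong (_+ 1) (+-identityʳ _) ⟩
    consecutive-sum F c + 1                      ≤⟨ +-monoˡ-≤ 1 (consecutive-sum≤c F full) ⟩
    ∑ c (λ u → ∑ c (F u)) + 1                    ≡⟨ cong (_+ 1) (∑-cong c λ u _ → ∑-*ˡ c (t u) ∣ u ∼∣) ⟩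
    outer-sum + 1                                ∎
    where
    open ≤-Reasoning
    F : Fin n → Fin n → ℕ
    F u v = t u * ∣ u ∼∣ v

  -- Adjacencies among outer vertices include both directions of every joint.
  f+2joints≤outer-sum : ∀ {p} → Trav p → f + 2 * joints p ≤ outer-sum
  f+2joints≤outer-sum {p} T = begin
    f + 2 * joints p                    ≡⟨ cong (f +_) (sym (consecutive-joints (Traversal.linked T))) ⟩
    f + consecutive-sum F p             ≤⟨ +-monoʳ-≤ f (consecutive-sum≤c F T) ⟩
    f + ∑ c (λ u → ∑ c (F u))           ≡⟨ cong (f +_) (∑-cong c λ u _ → ∑-*ˡ c (t u) (λ v → t v * ∣ u ∼∣ v)) ⟩
    f + ∑ c (λ u → t u * dt u)          ≡⟨ sym outer-split ⟩
    outer-sum                           ∎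
    where
    open ≤-Reasoning
    F : Fin n → Fin n → ℕ
    F u v = t u * (t v * ∣ u ∼∣ v)

  head-outer⇒heads : ∀ l {a m v} → v ∈ l → ¬ Inner v → Inner a → 1 ≤ heads (l ++ a ∷ m)
  head-outer⇒heads (y ∷ []) (here refl) ¬i ia rewrite t-outer ¬i | s-inner ia = s≤s z≤n
  head-outer⇒heads (y ∷ h ∷ l) (there v∈) ¬i ia = ≤-trans (head-outer⇒heads (h ∷ l) v∈ ¬i ia)
      (m≤n+m _ (t y * s h))
  head-outer⇒heads (y ∷ h ∷ l) {a} {m} (here refl) ¬i ia
    with inner? h | head-outer⇒heads (h ∷ l) {a} {m} (here refl)
  ... | yes ih | _ rewrite t-outer ¬i = s≤s z≤n
  ... | no ¬ih | rec = ≤-trans (rec ¬ih ia) (m≤n+m _ (t y * 0))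

  -- Rotation along the closing edge from `x₀` to `z` makes the vertex `a` before `z` an end, hence
  -- inner. Between the outer vertex `v` and `a` the path has to pass from outer to inner.
  outer⇒heads : ∀ {v} → v ∈ c → v ≢ z → ¬ Inner v → 1 ≤ heads c
  outer⇒heads {v} v∈c v≢z ¬i = go c₀ refl
    where
    go : ∀ d → c₀ ≡ d → 1 ≤ heads c
    go [] refl with long
    ... | s≤s ()
    go (h ∷ m) refl with split-last x₀ h m
    ... | l , a , eq with ∈-++⁻ (l ++ [ a ]) (subst (v ∈_) (trans eq (sym (++-assoc l [ a ] [ z ]))) v∈c)
    ...   | inj₂ (here v≡z) = ⊥-elim (v≢z v≡z)
    ...   | inj₁ v∈l+a with ∈-++⁻ l v∈l+a | end-inner (rotate l full eq closing)
    ...     | inj₁ v∈l         | ia = subst (λ e → 1 ≤ heads e) (sym eq) (head-outer⇒heads l v∈l ¬i ia)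
    ...     | inj₂ (here refl) | ia = ⊥-elim (¬i ia)

  side : ∀ v → Inner v ⊎ ¬ Inner v
  side v = toSum (inner? v)

  heads-inner : ∀ {y h} l → Inner y → heads (y ∷ h ∷ l) ≡ heads (h ∷ l)
  heads-inner {h = h} l i = cong (λ k → k * s h + heads (h ∷ l)) (t-inner i)

  heads-outer : ∀ {y h} l → ¬ Inner h → heads (y ∷ h ∷ l) ≡ heads (h ∷ l)
  heads-outer {y} {h} l ¬i = cong (_+ heads (h ∷ l)) (trans (cong (t y *_) (s-outer ¬i)) (*-zeroʳ (t y)))

  heads-entry : ∀ {y h} l → ¬ Inner y → Inner h → heads (y ∷ h ∷ l) ≡ suc (heads (h ∷ l))
  heads-entry {h = h} l ¬i i = cong (_+ heads (h ∷ l)) (cong₂ _*_ (t-outer ¬i) (s-inner i))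

  outer-block : ∀ d l → heads (d ∷ l) ≡ 1 → ¬ Inner d →
    ∃ λ τ → ∃₂ λ b B → l ≡ τ ++ b ∷ B × All (¬_ ∘ Inner) τ × Inner b × heads (b ∷ B) ≡ 0
  outer-block d (h ∷ l) H ¬d with side h
  ... | inj₁ i = [] , h , l , refl , [] , i , suc-injective (trans (sym (heads-entry l ¬d i)) H)
  ... | inj₂ ¬i with outer-block h l (trans (sym (heads-outer l ¬i)) H) ¬i
  ...   | τ , b , B , refl , all , rest = h ∷ τ , b , B , refl , ¬i ∷ all , rest

  inner-block : ∀ y l → heads (y ∷ l) ≡ 1 → Inner y →
    ∃₂ λ P a → ∃₂ λ d l′ → y ∷ l ≡ P ++ a ∷ d ∷ l′ × All Inner P × Inner a × ¬ Inner d × heads (d ∷ l′) ≡ 1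
  inner-block y (h ∷ l) H i with side h
  ... | inj₂ ¬h = [] , y , h , l , refl , [] , i , ¬h , trans (sym (heads-inner l i)) H
  ... | inj₁ ih with inner-block h l (trans (sym (heads-inner l i)) H) ih
  ...   | P , a , d , l′ , eq , all , rest = y ∷ P , a , d , l′ , cong (y ∷_) eq , i ∷ all , rest

  all-outer : ∀ w l → heads (w ∷ l) ≡ 0 → ¬ Inner w → All (¬_ ∘ Inner) (w ∷ l)
  all-outer w []      H ¬w = ¬w ∷ []
  all-outer w (h ∷ l) H ¬w with side h
  ... | inj₂ ¬h = ¬w ∷ all-outer h l (trans (sym (heads-outer l ¬h)) H) ¬h
  ... | inj₁ i with trans (sym (heads-entry l ¬w i)) H
  ...   | ()

  outer-∑ : ∀ {l} → All (¬_ ∘ Inner) l → ∀ (G : Fin n → ℕ) → ∑ l (λ u → s u * G u) ≡ 0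
  outer-∑ {l} all G = ∑-0 l λ u u∈l → cong (_* G u) (s-outer (All.lookup all u∈l))

  outer-∑s : ∀ {l} → All (¬_ ∘ Inner) l → ∑ l s ≡ 0
  outer-∑s {l} all = ∑-0 l λ u u∈l → s-outer (All.lookup all u∈l)

  -- Without heads the inner vertices form an initial run, and all but the last of them are followed
  -- by an inner vertex.
  inner-run≤1 : ∀ (G : Fin n → ℕ) y l → heads (y ∷ l) ≡ 0 → (∀ u → G u ≤ 1) →
    (∀ k {u w m} → y ∷ l ≡ k ++ u ∷ w ∷ m → Inner w → G u ≡ 0) → ∑ (y ∷ l) (λ u → s u * G u) ≤ 1
  inner-run≤1 G y [] H G≤1 G≡0 = ≤-trans (≤-reflexive (+-identityʳ _)) (*-mono-≤ (s≤1 y) (G≤1 y))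
  inner-run≤1 G y (w ∷ l) H G≤1 G≡0 with side w
  ... | inj₂ ¬w rewrite outer-∑ (all-outer w l (trans (sym (heads-outer {y} l ¬w)) H) ¬w) G =
    ≤-trans (≤-reflexive (+-identityʳ _)) (*-mono-≤ (s≤1 y) (G≤1 y))
  ... | inj₁ i rewrite G≡0 [] refl i | *-zeroʳ (s y) =
    inner-run≤1 G w l (m+n≡0⇒n≡0 (t y * s w) H) G≤1 (λ k eq → G≡0 (y ∷ k) (cong (y ∷_) eq))

  -- The extra `L` pays for the last vertex of the inner run, to which the bound does not apply.
  inner-run≥ : ∀ (G : Fin n → ℕ) L y l → heads (y ∷ l) ≡ 0 →
    (∀ k {u w m} → y ∷ l ≡ k ++ u ∷ w ∷ m → Inner u → Inner w → L ≤ G u) →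
    L * ∑ (y ∷ l) s ≤ ∑ (y ∷ l) (λ u → s u * G u) + L
  inner-run≥ G L y [] H L≤G = begin
    L * (s y + 0)       ≡⟨ cong (L *_) (+-identityʳ (s y)) ⟩
    L * s y             ≤⟨ *-monoʳ-≤ L (s≤1 y) ⟩
    L * 1               ≡⟨ *-identityʳ L ⟩
    L                   ≤⟨ m≤n+m L _ ⟩
    s y * G y + 0 + L   ∎
    where open ≤-Reasoning
  inner-run≥ G L y (w ∷ l) H L≤G with side w
  ... | inj₂ ¬w rewrite outer-∑s (all-outer w l (trans (sym (heads-outer {y} l ¬w)) H) ¬w) = begin
    L * (s y + 0)       ≡⟨ cong (L *_) (+-identityʳ (s y)) ⟩
    L * s y             ≤⟨ *-monoʳ-≤ L (s≤1 y) ⟩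
    L * 1               ≡⟨ *-identityʳ L ⟩
    L                   ≤⟨ m≤n+m L _ ⟩
    _ + L               ∎
    where open ≤-Reasoning
  ... | inj₁ i = begin
    L * (s y + X)       ≡⟨ *-distribˡ-+ L (s y) X ⟩
    L * s y + L * X     ≤⟨ +-mono-≤ local
        (inner-run≥ G L w l (m+n≡0⇒n≡0 (t y * s w) H) (λ k eq → L≤G (y ∷ k) (cong (y ∷_) eq))) ⟩
    s y * G y + (Y + L) ≡⟨ sym (+-assoc (s y * G y) Y L) ⟩
    s y * G y + Y + L   ∎
    where
    open ≤-Reasoning
    X = ∑ (w ∷ l) s
    Y = ∑ (w ∷ l) (λ u → s u * G u)
    local : L * s y ≤ s y * G y
    local with side y
    ... | inj₁ iy rewrite s-inner iy = ≤-trans (≤-reflexive (*-identityʳ L))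
        (≤-trans (L≤G [] refl iy i) (≤-reflexive (sym (+-identityʳ (G y)))))
    ... | inj₂ ¬y rewrite s-outer ¬y = ≤-reflexive (*-zeroʳ L)

  entry-pair : ∀ (d : Fin n) τ {b B} → ∃ λ l → d ∷ τ ++ b ∷ B ≡ l ++ lastOr d τ ∷ b ∷ B
  entry-pair d []      = [] , refl
  entry-pair d (e ∷ τ) with entry-pair e τ
  ... | l , eq = d ∷ l , cong (d ∷_) eq

  module _ (8≤degree : ∀ {v} → v ∈ c → Inner v → 8 ≤ degree v) where

    -- All neighbours of an inner vertex are on `c`, so it contributes at least 8 to the sum of
    -- inner degrees.
    few-sum : 8 * S + outer-sum ≤ 60 + 2 * (S + T#)
    few-sum = begin
      8 * S + outer-sum                          ≡⟨ cong (_+ outer-sum) (sym (∑-*ˡ c 8 s)) ⟩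
      ∑ c (λ u → 8 * s u) + outer-sum            ≤⟨ +-monoˡ-≤ outer-sum (∑-mono c inner-part) ⟩
      ∑ c (λ u → s u * dc u) + outer-sum         ≡⟨ sym (∑-+ c (λ u → s u * dc u) (λ u → t u * dc u)) ⟩
      ∑ c (λ u → s u * dc u + t u * dc u)        ≡⟨ ∑-cong c
          (λ u _ → trans (sym (*-distribʳ-+ (dc u) (s u) (t u)))
                                                      (trans (cong (_* dc u) (s+t u)) (*-identityˡ _))) ⟩
      ∑ c dc                                     ≤⟨ few {x₀} {c₀} cyc ⟩
      60 + 2 * length c                          ≡⟨ cong (λ k → 60 + 2 * k) length-c ⟩
      60 + 2 * (S + T#)                          ∎
      where
      open ≤-Reasoning
      inner-part : ∀ u → u ∈ c → 8 * s u ≤ s u * dc u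
      inner-part u u∈c with inner? u
      ... | yes i = ≤-trans (8≤degree u∈c i) (≤-trans (inner-degree i) (≤-reflexive (sym (+-identityʳ (dc u)))))
      ... | no _  = z≤n

    -- `2T#≤outer-sum` cancels the share of the outer vertices, which leaves `6 * S ≤ 61`.
    S≤10 : S ≤ 10
    S≤10 = ≮⇒≥ λ 11≤S → farkas (S ∷ T# ∷ outer-sum ∷ [])
      ( (1 , 8 ⊛ vS ⊕ vO , con 60 ⊕ 2 ⊛ (vS ⊕ vT))
      ∷ (1 , 2 ⊛ vT , vO ⊕ con 1)
      ∷ (6 , con 11 , vS) ∷ [])
      (few-sum ∷ 2T#≤outer-sum ∷ 11≤S ∷ [])
      where
      vS = var (# 0) ; vT = var (# 1) ; vO = var (# 2)

    -- `end-ds` limits the inner neighbours; the rest of the degree 8 must be outer.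
    end-dt : ∀ {x q} → Trav (x ∷ q) → 9 + heads (x ∷ q) ≤ dt x + S
    end-dt {x} {q} T = ≮⇒≥ λ lt → farkas (S ∷ ds x ∷ dt x ∷ heads (x ∷ q) ∷ [])
      ( (1 , vD ⊕ vH ⊕ con 1 , vS)
      ∷ (1 , con 8 , vD ⊕ vE)
      ∷ (1 , con 1 ⊕ (vE ⊕ vS) , con 9 ⊕ vH) ∷ [])
      (end-ds T ∷ ≤-trans (8≤degree x∈c i) (≤-trans (inner-degree i) (≤-reflexive (dc-split x))) ∷ lt ∷ [])
      where
      i = end-inner T
      x∈c = ∈-resp-↭ (Traversal.perm T) (here refl)
      vS = var (# 0) ; vD = var (# 1) ; vE = var (# 2) ; vH = var (# 3)

    -- The joints cancel once `T#` is written as heads plus joints plus 1.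
    f-upper : ∀ {x q} → Trav (x ∷ q) → 6 * S + f ≤ 62 + 2 * heads (x ∷ q)
    f-upper {x} {q} T = ≮⇒≥ λ lt → farkas (S ∷ T# ∷ outer-sum ∷ f ∷ heads (x ∷ q) ∷ joints (x ∷ q) ∷ [])
      ( (1 , 8 ⊛ vS ⊕ vO , con 60 ⊕ 2 ⊛ (vS ⊕ vT))
      ∷ (1 , vf ⊕ 2 ⊛ vJ , vO)
      ∷ (2 , vT , vH ⊕ vJ ⊕ con 1)
      ∷ (1 , con 1 ⊕ (con 62 ⊕ 2 ⊛ vH) , 6 ⊛ vS ⊕ vf) ∷ [])
      (few-sum ∷ f+2joints≤outer-sum T ∷ ≤-reflexive (sym (trav-heads T)) ∷ lt ∷ [])
      where
      vS = var (# 0) ; vT = var (# 1) ; vO = var (# 2) ; vf = var (# 3) ; vH = var (# 4) ; vJ = var (# 5)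

    -- The neighbours of `x`, at least 8, have as many predecessors, all of which are inner.
    f-lower : ∀ {x q} → Trav (x ∷ q) → ∀ L →
              (∀ l {a h m} → x ∷ q ≡ l ++ a ∷ h ∷ m → x ∼ h → L ≤ dt a) → 8 * L ≤ f
    f-lower {x} {q} T L bound = begin
      8 * L                           ≤⟨ *-monoˡ-≤ L (≤-trans (8≤degree x∈c (end-inner T)) (trav-degree T)) ⟩
      ∑ q ∣ x ∼∣ * L                  ≤⟨ preds-bound x L (λ a → s a * dt a) x q bound′ ⟩
      ∑ (x ∷ q) (λ a → s a * dt a)    ≡⟨ ∑-↭ (λ a → s a * dt a) (Traversal.perm T) ⟩
      f                               ∎
      where
      open ≤-Reasoning
      x∈c = ∈-resp-↭ (Traversal.perm T) (here refl)
      bound′ : ∀ l {a h m} → x ∷ q ≡ l ++ a ∷ h ∷ m → x ∼ h → L ≤ s a * dt a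
      bound′ l {a} eq x∼h rewrite s-inner (end-inner (rotate l T eq x∼h)) | +-identityʳ (dt a) = bound l eq x∼h

    -- Rotation preserves heads, so `m` bounds `dt` from below at every rotated end. Then
    -- `8 * (9 + H - S) ≤ f ≤ 62 + 2 * H - 6 * S` gives `6 * H + 10 ≤ 2 * S ≤ 20`: `H` is at most 1,
    -- and 1 requires `8 ≤ S`.
    heads-forced : ∀ {x q} → Trav (x ∷ q) → 1 ≤ heads (x ∷ q) → heads (x ∷ q) ≡ 1 × 8 ≤ S × 6 * S + f ≤ 64
    heads-forced {x} {q} T 1≤H = H≡1 , ≮⇒≥ S≮8 , subst (λ h → 6 * S + f ≤ 62 + 2 * h) H≡1 (f-upper T)
      where
      H = heads (x ∷ q)
      m = (9 + H) ∸ S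
      8m≤f : 8 * m ≤ f
      8m≤f = f-lower T m λ l {a} {h} {r} eq x∼h → begin
        m                                      ≡⟨ cong (λ k → 9 + k ∸ S) (sym (rotate-heads l T eq x∼h)) ⟩
        9 + heads (a ∷ (l ʳ++ h ∷ r)) ∸ S      ≤⟨ m≤n+o⇒m∸n≤o _ S
            (≤-trans (end-dt (rotate l T eq x∼h)) (≤-reflexive (+-comm (dt a) S))) ⟩
        dt a             ∎
        where open ≤-Reasoning
      vS = var (# 0) ; vf = var (# 1) ; vH = var (# 2) ; vm = var (# 3)
      ρ = S ∷ f ∷ H ∷ m ∷ []
      H≡1 : H ≡ 1
      H≡1 = ≤-antisym (≮⇒≥ λ 2≤H → farkas ρ
              ( (1 , 6 ⊛ vS ⊕ vf , con 62 ⊕ 2 ⊛ vH)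
              ∷ (1 , 8 ⊛ vm , vf)
              ∷ (8 , con 9 ⊕ vH , vS ⊕ vm)
              ∷ (2 , vS , con 10)
              ∷ (6 , con 2 , vH) ∷ [])
              (f-upper T ∷ 8m≤f ∷ m≤n+m∸n (9 + H) S ∷ S≤10 ∷ 2≤H ∷ [])) 1≤H
      S≮8 : ¬ S < 8
      S≮8 S<8 = farkas ρ
              ( (1 , 6 ⊛ vS ⊕ vf , con 62 ⊕ 2 ⊛ vH)
              ∷ (1 , 8 ⊛ vm , vf)
              ∷ (8 , con 9 ⊕ vH , vS ⊕ vm)
              ∷ (2 , con 1 ⊕ vS , con 8)
              ∷ (6 , con 1 , vH) ∷ [])
              (f-upper T ∷ 8m≤f ∷ m≤n+m∸n (9 + H) S ∷ S<8 ∷ 1≤H ∷ [])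

    -- Counting forces x to be adjacent to all inner vertices but x and b, so rotation turns every
    -- vertex of P, and every vertex of b ∷ B followed by an inner one, into an end.  The former
    -- ends miss b, the latter miss a, hence a and b have too many outer neighbours.
    module TwoBlocks {x q P a d τ b B} (T : Trav (x ∷ q)) (H≡1 : heads (x ∷ q) ≡ 1)
      (8≤S : 8 ≤ S) (f≤ : 6 * S + f ≤ 64) (dt≤ : dt x ≤ 10 ∸ S)
      (eq : x ∷ q ≡ P ++ a ∷ d ∷ τ ++ b ∷ B) (innerP : All Inner P) (ia : Inner a)
      (outer : All (¬_ ∘ Inner) (d ∷ τ)) (ib : Inner b) (H≡0 : heads (b ∷ B) ≡ 0) where

      L : ℕ
      L = 10 ∸ S

      uq : Unique (x ∷ q)
      uq = trav-unique T

      in-c : ∀ {v} → v ∈ x ∷ q → v ∈ c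
      in-c = ∈-resp-↭ (Traversal.perm T)

      unique-head : ∀ {v : Fin n} {r w} → Unique (v ∷ r) → w ∈ r → v ≢ w
      unique-head (v≢ ∷ _) w∈r = All.lookup v≢ w∈r

      entry : ∃ λ k → d ∷ τ ++ b ∷ B ≡ k ++ lastOr d τ ∷ b ∷ B
      entry = entry-pair d τ

      outer-entry : ¬ Inner (lastOr d τ)
      outer-entry = All.lookup outer (lastOr-∈ d τ)

      entry-at : x ∷ q ≡ (P ++ a ∷ proj₁ entry) ++ lastOr d τ ∷ b ∷ B
      entry-at = trans eq (trans (cong (λ r → P ++ a ∷ r) (proj₂ entry)) (sym (++-assoc P (a ∷ proj₁ entry) _)))

      x≁b : ¬ x ∼ b
      x≁b = nonadjacent (P ++ a ∷ proj₁ entry) T entry-at outer-entry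

      S≤ds+2 : S ≤ ds x + 2
      S≤ds+2 = ≮⇒≥ λ lt → farkas (S ∷ ds x ∷ dt x ∷ L ∷ [])
        ( (1 , con 8 , vD ⊕ vE) ∷ (1 , vE , vL) ∷ (1 , vL ⊕ vS , con 10) ∷ (1 , con 1 ⊕ (vD ⊕ con 2) , vS) ∷ [])
        ( ≤-trans (8≤degree (in-c (here refl)) i) (≤-trans (inner-degree i) (≤-reflexive (dc-split x)))
        ∷ dt≤ ∷ ≤-reflexive (m∸n+n≡m (S≤10)) ∷ lt ∷ [])
        where
        i = end-inner T
        vS = var (# 0) ; vD = var (# 1) ; vE = var (# 2) ; vL = var (# 3)

      -- The inner non-neighbours of `x`: at most two by `S≤ds+2`, and `x` and `b` are already two.
      g : Fin n → ℕ
      g u = s u * ⟦ not (adj x u) ⟧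

      g≡1 : ∀ {v} → Inner v → ¬ x ∼ v → g v ≡ 1
      g≡1 i x≁v = cong₂ _*_ (s-inner i) (cong (λ β → ⟦ not β ⟧) (Bool.¬-not x≁v))

      S-split : S ≡ ds x + ∑ c g
      S-split = trans (∑-cong c λ u _ → local u) (∑-+ c (λ u → s u * ∣ x ∼∣ u) g)
        where
        local : ∀ u → s u ≡ s u * ∣ x ∼∣ u + g u
        local u with adj x u
        ... | true  = sym (trans (cong₂ _+_ (*-identityʳ (s u)) (*-zeroʳ (s u))) (+-identityʳ (s u)))
        ... | false = sym (trans (cong₂ _+_ (*-zeroʳ (s u)) (*-identityʳ (s u))) refl)

      adjacent : ∀ {w} → w ∈ q → Inner w → b ≢ w → x ∼ w
      adjacent {w} w∈q iw b≢w with x ∼? w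
      ... | yes x∼w = x∼w
      ... | no x≁w = ⊥-elim (farkas (S ∷ ds x ∷ ∑ c g ∷ [])
        ( (1 , vD ⊕ vg , vS) ∷ (1 , con 3 , vg) ∷ (1 , vS , vD ⊕ con 2) ∷ [])
        ( ≤-reflexive (sym S-split) ∷ three ∷ S≤ds+2 ∷ []))
        where
        vS = var (# 0) ; vD = var (# 1) ; vg = var (# 2)
        b∈q = second-∈-tail (P ++ a ∷ proj₁ entry) entry-at
        in-list : ∀ v → v ∈ x ∷ b ∷ w ∷ [] → v ∈ c
        in-list v (here refl)                 = in-c (here refl)
        in-list v (there (here refl))         = in-c (there b∈q)
        in-list v (there (there (here refl))) = in-c (there w∈q)
        three : 3 ≤ ∑ c g
        three = ≤-trans (≤-reflexive (sym (cong₂ _+_ (g≡1 (end-inner T) ∼-irr)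
                          (cong₂ _+_ (g≡1 ib x≁b) (cong (_+ 0) (g≡1 iw x≁w))))))
          (∑-⊆ g ((unique-head uq b∈q ∷ unique-head uq w∈q ∷ []) ∷ (b≢w ∷ []) ∷ [] ∷ []) λ v → inj₂ ∘ in-list v)

      L≤dt : ∀ {y r} → Trav (y ∷ r) → heads (y ∷ r) ≡ 1 → L ≤ dt y
      L≤dt {y} T′ H′ = m≤n+o⇒m∸n≤o 10 S
        (≤-trans (≤-reflexive (cong (9 +_) (sym H′))) (≤-trans (end-dt T′) (≤-reflexive (+-comm (dt y) S))))

      -- The successor `w` of `y` is inner and not `b`, hence a neighbour of `x`. The rotated path
      -- still enters `b` from an outer vertex.
      P-ends : ∀ {y} → y ∈ P → ¬ y ∼ b × L ≤ dt y
      P-ends {y} y∈P with ∈-∃++ y∈P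
      ... | k , k′ , P≡ = go k′ refl
        where
        R = d ∷ τ ++ b ∷ B
        finish : ∀ w r j → k′ ++ a ∷ R ≡ w ∷ r → Inner w → b ∈ r → w ∷ r ≡ j ++ lastOr d τ ∷ b ∷ B → ¬ y ∼ b
            × L ≤ dt y
        finish w r j next iw b∈r r≡ =
            nonadjacent (y ∷ (k ʳ++ j)) T′ (cong (y ∷_) (trans (cong (k ʳ++_) r≡) (sym (ʳ++-++ k)))) outer-entry
          , L≤dt T′ (trans (rotate-heads k T at x∼w) H≡1)
          where
          at : x ∷ q ≡ k ++ y ∷ w ∷ r
          at = trans eq (trans (cong (_++ a ∷ R) P≡)
              (trans (++-assoc k (y ∷ k′) (a ∷ R)) (cong (λ e → k ++ y ∷ e) next)))
          uw : Unique (w ∷ r)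
          uw = Unique-++⁻ʳ (k ++ [ y ]) (subst Unique (trans at (sym (++-assoc k [ y ] (w ∷ r)))) uq)
          x∼w = adjacent (second-∈-tail k at) iw (λ b≡w → unique-head uw b∈r (sym b≡w))
          T′ = rotate k T at x∼w
        b∈R : b ∈ R
        b∈R = ∈-++⁺ʳ (d ∷ τ) (here refl)
        go : ∀ m → k′ ≡ m → ¬ y ∼ b × L ≤ dt y
        go []      refl = finish a R (a ∷ proj₁ entry) refl ia b∈R (cong (a ∷_) (proj₂ entry))
        go (w ∷ m) refl = finish w (m ++ a ∷ R) (w ∷ m ++ a ∷ proj₁ entry) refl
          (All.lookup innerP (subst (w ∈_) (sym P≡) (∈-++⁺ʳ k (there (here refl)))))
          (∈-++⁺ʳ m (there b∈R))
          (cong (w ∷_) (trans (cong (λ r → m ++ a ∷ r) (proj₂ entry)) (sym (++-assoc m (a ∷ proj₁ entry) _))))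

      -- Here the rotation reverses the outer block, so that `d` comes to precede `a`.
      B-ends : ∀ k {y w m} → b ∷ B ≡ k ++ y ∷ w ∷ m → Inner w → ¬ y ∼ a × L ≤ dt y
      B-ends k {y} {w} {m} B≡ iw =
          nonadjacent (y ∷ ((τ ++ k) ʳ++ [])) T′
            (cong (y ∷_) (trans (++-ʳ++ P) (sym (ʳ++-++ (τ ++ k))))) (All.lookup outer (here refl))
        , L≤dt T′ (trans (rotate-heads front T at x∼w) H≡1)
        where
        front = P ++ a ∷ d ∷ τ ++ k
        at : x ∷ q ≡ front ++ y ∷ w ∷ m
        at = trans eq (trans (cong (λ r → P ++ a ∷ d ∷ τ ++ r) B≡)
               (trans (cong (λ r → P ++ a ∷ d ∷ r) (sym (++-assoc τ k _)))
                   (sym (++-assoc P (a ∷ d ∷ τ ++ k) _))))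
        ub : Unique (b ∷ B)
        ub = Unique-++⁻ʳ (P ++ a ∷ d ∷ τ) (subst Unique (trans eq (sym (++-assoc P (a ∷ d ∷ τ) (b ∷ B)))) uq)
        x∼w = adjacent (second-∈-tail front at) iw (unique-head ub (second-∈-tail k B≡))
        T′ = rotate front T at x∼w

      ∑-blocks : ∀ w → ∑ c w ≡ ∑ P w + (w a + (∑ (d ∷ τ) w + (w b + ∑ B w)))
      ∑-blocks w = trans (sym (∑-↭ w (Traversal.perm T))) (trans (cong (λ l → ∑ l w) eq)
        (trans (∑-++ P _ w) (cong (λ k → ∑ P w + (w a + k)) (∑-++ (d ∷ τ) (b ∷ B) w))))

      s*≤s : ∀ v u → s u * ∣ v ∼∣ u ≤ s u
      s*≤s v u = ≤-trans (*-monoʳ-≤ (s u) (⟦⟧≤1 (adj v u))) (≤-reflexive (*-identityʳ (s u)))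

      s*∼≡0 : ∀ {v u} → ¬ v ∼ u → s u * ∣ v ∼∣ u ≡ 0
      s*∼≡0 {v} {u} v≁u = trans (cong (s u *_) (∣∼∣-no v≁u)) (*-zeroʳ (s u))

      -- In `b ∷ B` only the last inner vertex can be adjacent to `a`, since the others are
      -- `B-ends`.
      ds-a : ds a ≤ ∑ P s + 1
      ds-a = begin
        ds a                                                     ≡⟨ ∑-blocks w ⟩
        ∑ P w + (w a + (∑ (d ∷ τ) w + ∑ (b ∷ B) w))              ≡⟨ cong₂
            (λ i j → ∑ P w + (i + (j + ∑ (b ∷ B) w)))
                                                                      (s*∼≡0 ∼-irr) (outer-∑ outer ∣ a ∼∣) ⟩
        ∑ P w + ∑ (b ∷ B) w                                      ≤⟨ +-mono-≤ (∑-mono P λ u _ → s*≤s a u)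
                                                                      (inner-run≤1 ∣ a ∼∣ b B H≡0 (λ u →
                                                                          ⟦⟧≤1 (adj a u))
                                                                        λ k B≡ iw → ∣∼∣-no (proj₁ (B-ends k
                                                                            B≡ iw) ∘ ∼-sym)) ⟩
        ∑ P s + 1                                                ∎
        where
        open ≤-Reasoning
        w : Fin n → ℕ
        w u = s u * ∣ a ∼∣ u

      -- `P-ends` excludes all of `P`, which leaves `a` and the inner vertices of `B`.
      ds-b : ds b ≤ 1 + ∑ B s
      ds-b = begin
        ds b                                                     ≡⟨ ∑-blocks w ⟩
        ∑ P w + (w a + (∑ (d ∷ τ) w + (w b + ∑ B w)))            ≡⟨ cong₂
            (λ i j → i + (w a + (j + (w b + ∑ B w))))
                                                                      (∑-0 P λ u u∈P → s*∼≡0 (proj₁ (P-ends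
                                                                          u∈P) ∘ ∼-sym))
                                                                      (outer-∑ outer ∣ b ∼∣) ⟩
        w a + (w b + ∑ B w)                                      ≡⟨ cong (λ i → w a + (i + ∑ B w))
            (s*∼≡0 ∼-irr) ⟩
        w a + ∑ B w                                              ≤⟨ +-mono-≤ (≤-trans (s*≤s b a) (s≤1 a))
            (∑-mono B λ u _ → s*≤s b u) ⟩
        1 + ∑ B s                                                ∎
        where
        open ≤-Reasoning
        w : Fin n → ℕ
        w u = s u * ∣ b ∼∣ u

      8≤ds+dt : ∀ {v} → v ∈ x ∷ q → Inner v → 8 ≤ ds v + dt v
      8≤ds+dt {v} v∈ i = ≤-trans (8≤degree (in-c v∈) i) (≤-trans (inner-degree i) (≤-reflexive (dc-split v)))

      B-weight : L * ∑ B s ≤ ∑ B (λ u → s u * dt u) + L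
      B-weight = go B refl
        where
        go : ∀ B′ → B ≡ B′ → L * ∑ B′ s ≤ ∑ B′ (λ u → s u * dt u) + L
        go []       B≡ = ≤-trans (≤-reflexive (*-zeroʳ L)) z≤n
        go (w ∷ B′) B≡ = inner-run≥ dt L w B′
          (m+n≡0⇒n≡0 (t b * s w) (trans (cong (λ r → heads (b ∷ r)) (sym B≡)) H≡0))
          λ k eq′ _ iw → proj₂ (B-ends (b ∷ k) (cong (b ∷_) (trans B≡ eq′)) iw)

      impossible : ⊥
      impossible = final-count S f (∑ P s) (∑ B s) (dt a) (dt b) (∑ P w) (∑ B w) 8≤S (S≤10)
        (trans (∑-blocks s) (trans (cong₂ (λ i j → ∑ P s + (i + (j + (s b + ∑ B s)))) (s-inner ia)
            (outer-∑s outer))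
          (trans (cong (λ i → ∑ P s + (1 + (i + ∑ B s))) (s-inner ib)) (regroup (∑ P s) (∑ B s)))))
        (≤-trans (8≤ds+dt a∈ ia) (+-monoˡ-≤ (dt a) ds-a))
        (≤-trans (8≤ds+dt b∈ ib) (+-monoˡ-≤ (dt b) ds-b))
        (≤-trans (≤-reflexive (sym (∑-*ˡ P L s)))
            (∑-mono P λ u u∈P → subst (λ i → L * i ≤ i * dt u) (sym (s-inner (All.lookup innerP u∈P)))
          (≤-trans (≤-reflexive (*-identityʳ L))
              (≤-trans (proj₂ (P-ends u∈P)) (≤-reflexive (sym (+-identityʳ (dt u))))))))
        B-weight
        (≤-reflexive (sym (trans (∑-blocks w)
            (trans (cong₂ (λ i j → ∑ P w + (i * dt a + (j + (s b * dt b + ∑ B w)))) (s-inner ia)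
                (outer-∑ outer dt))
          (trans (cong (λ i → ∑ P w + (dt a + 0 + (i * dt b + ∑ B w))) (s-inner ib))
              (regroup′ (∑ P w) (dt a) (dt b) (∑ B w)))))))
        f≤
        where
        w : Fin n → ℕ
        w u = s u * dt u
        a∈ = subst (a ∈_) (sym eq) (∈-++⁺ʳ P (here refl))
        b∈ = subst (b ∈_) (sym entry-at) (∈-++⁺ʳ (P ++ a ∷ proj₁ entry) (there (here refl)))
        regroup : ∀ α β → α + (1 + (1 + β)) ≡ α + β + 2
        regroup = solve-∀
        regroup′ : ∀ X i j Y → X + (i + 0 + (j + 0 + Y)) ≡ X + i + j + Y
        regroup′ = solve-∀

    -- With one head, `TwoBlocks` raises the bound on `dt` at every rotated end from `10 - S` to
    -- `11 - S`; then `8 * (11 - S) ≤ f ≤ 64 - 6 * S` would require `S` to be at least 12.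
    every-inner : ∀ {v} → v ∈ c → v ≢ z → Inner v
    every-inner {v} v∈c v≢z with inner? v
    ... | yes i = i
    ... | no ¬i with heads-forced full (outer⇒heads v∈c v≢z ¬i)
    ...   | H≡1 , 8≤S , f≤ = ⊥-elim (f-small S f 8≤S (S≤10) f≤ (f-lower full (11 ∸ S) bound))
      where
      f-small : ∀ S f → 8 ≤ S → S ≤ 10 → 6 * S + f ≤ 64 → 8 * (11 ∸ S) ≤ f → ⊥
      f-small S f 8≤S S≤10 f≤ f≥ with m≤n⇒∃[o]m+o≡n 8≤S
      ... | 0 , refl = farkas (f ∷ []) ((1 , con 48 ⊕ var (# 0) , con 64) ∷ (1 , con 24 , var (# 0)) ∷ [])
          (f≤ ∷ f≥ ∷ [])
      ... | 1 , refl = farkas (f ∷ []) ((1 , con 54 ⊕ var (# 0) , con 64) ∷ (1 , con 16 , var (# 0)) ∷ [])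
          (f≤ ∷ f≥ ∷ [])
      ... | 2 , refl = farkas (f ∷ []) ((1 , con 60 ⊕ var (# 0) , con 64) ∷ (1 , con 8 , var (# 0)) ∷ [])
          (f≤ ∷ f≥ ∷ [])
      ... | suc (suc (suc k)) , refl = m+1+n≰m 10 S≤10
      two-blocks : ∀ {x q} → Trav (x ∷ q) → heads (x ∷ q) ≡ 1 → ¬ dt x ≤ 10 ∸ S
      two-blocks {x} {q} T H dt≤ with inner-block x q H (end-inner T)
      ... | P , a , d , l , eq , innerP , ia , ¬d , H′ with outer-block d l H′ ¬d
      ...   | τ , b , B , refl , outer , ib , H≡0 =
        TwoBlocks.impossible T H 8≤S f≤ dt≤ eq innerP ia (¬d ∷ outer) ib H≡0
      bound : ∀ l {a h m} → c ≡ l ++ a ∷ h ∷ m → x₀ ∼ h → 11 ∸ S ≤ dt a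
      bound l {a} eq x₀∼h = ≤-trans (≤-reflexive (+-∸-assoc 1 (S≤10)))
        (≰⇒> (two-blocks (rotate l full eq x₀∼h) (trans (rotate-heads l full eq x₀∼h) H≡1)))

-- Optimal paths and the cycles with closed ends that they contain.

lastOr-append : ∀ {A : Set} (d : A) l m → lastOr d (l ++ m) ≡ lastOr (lastOr d l) m
lastOr-append d []      m = refl
lastOr-append d (x ∷ l) m = lastOr-append x l m

successor : ∀ {A : Set} {R : Rel A 0ℓ} {x l v} → Linked R (x ∷ l) → v ∈ x ∷ l → v ≢ lastOr x l → ∃ (R v)
successor [-]     (here refl) v≢ = ⊥-elim (v≢ refl)
successor (r ∷ _) (here refl) v≢ = _ , r
successor (_ ∷ p) (there v∈)  v≢ = successor p v∈ v≢

module Search {n : ℕ} (A : Adjacency n) (r : Fin n) where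

  open Adjacency A

  -- A path from x to r whose first part, ending in z, is a single vertex or spans a cycle.
  record Lasso : Set where
    field
      x z      : Fin n
      c t      : List (Fin n)
      last-c   : lastOr x c ≡ z
      linked-c : Linked _∼_ (x ∷ c)
      linked-t : Linked _∼_ (z ∷ t)
      unique   : Unique (x ∷ c ++ t)
      closing  : c ≡ [] ⊎ x ∼ z
      root     : lastOr z t ≡ r
      -- Excludes the path consisting of `r` alone, which would offer no cycle.
      2≤size   : 2 ≤ length (x ∷ c ++ t)

  open Lasso

  size : Lasso → ℕ
  size w = length (x w ∷ c w ++ t w)

  Closed : Lasso → Set
  Closed w = ∀ {y q} → Traversal (x w ∷ c w) (z w) (y ∷ q) → ∀ u → y ∼ u → u ∈ x w ∷ c w

  -- A neighbour `u` off the whole path prolongs it, at the price of restarting with the single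
  -- vertex `u`; a neighbour on the tail closes a larger cycle and leaves a shorter tail.
  improve : ∀ w → (∀ w′ → size w < size w′ → ⊥) →
      (∀ w′ → size w ≡ size w′ → length (t w′) < length (t w) → ⊥) → Closed w
  improve w longer wider {y} {q} T u y∼u with u ∈? (x w ∷ c w) | u ∈? t w
  ... | yes u∈c | _ = u∈c
  ... | no u∉c | no u∉t = ⊥-elim (longer w′ (≤-reflexive (cong suc (sym (↭-length moved)))))
    where
    open Traversal T
    moved : y ∷ q ++ t w ↭ x w ∷ c w ++ t w
    moved = ++⁺ʳ (t w) perm
    w′ : Lasso
    w′ = record
      { x = u ; z = u ; c = [] ; t = y ∷ q ++ t w
      ; last-c   = refl
      ; linked-c = [-]
      ; linked-t = ∼-sym y∼u ∷ Linked-++ linked (subst (λ e → Linked _∼_ (e ∷ t w)) (sym end) (linked-t w))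
      ; unique   = All.tabulate (λ v∈ u≡v → [ u∉c , u∉t ]′
          (∈-++⁻ (x w ∷ c w) (subst (_∈ _) (sym u≡v) (∈-resp-↭ moved v∈))))
                   ∷ Unique-resp-↭ (↭-sym moved) (unique w)
      ; closing  = inj₁ refl
      ; root     = trans (lastOr-append y q (t w)) (trans (cong (λ e → lastOr e (t w)) end) (root w))
      ; 2≤size   = s≤s (s≤s z≤n)
      }
  ... | no u∉c | yes u∈t with ∈-∃++ u∈t
  ...   | t₁ , t₂ , t≡ = ⊥-elim (wider w′ (sym same) shorter)
    where
    open Traversal T
    regroup : y ∷ (q ++ t₁ ++ [ u ]) ++ t₂ ≡ y ∷ q ++ t w
    regroup = cong (y ∷_) (trans (++-assoc q (t₁ ++ [ u ]) t₂)
                (cong (q ++_) (trans (++-assoc t₁ [ u ] t₂) (sym t≡))))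
    moved : y ∷ (q ++ t₁ ++ [ u ]) ++ t₂ ↭ x w ∷ c w ++ t w
    moved = subst (_↭ x w ∷ c w ++ t w) (sym regroup) (++⁺ʳ (t w) perm)
    same : length (y ∷ (q ++ t₁ ++ [ u ]) ++ t₂) ≡ size w
    same = ↭-length moved
    shorter : length t₂ < length (t w)
    shorter = subst (λ l → length t₂ < length l) (sym t≡)
      (≤-trans (m≤n+m (suc (length t₂)) (length t₁)) (≤-reflexive (sym (length-++ t₁))))
    linked-zt : Linked _∼_ (z w ∷ t₁ ++ u ∷ t₂)
    linked-zt = subst (λ l → Linked _∼_ (z w ∷ l)) t≡ (linked-t w)
    w′ : Lasso
    w′ = record
      { x = y ; z = u ; c = q ++ t₁ ++ [ u ] ; t = t₂
      ; last-c   = trans (cong (lastOr y) (sym (++-assoc q t₁ [ u ]))) (lastOr-++ (q ++ t₁))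
      ; linked-c = Linked-++ linked (subst (λ e → Linked _∼_ (e ∷ t₁ ++ [ u ])) (sym end)
          (Linked-++⁻ˡ (z w ∷ t₁) linked-zt))
      ; linked-t = Linked-++⁻ʳ (z w ∷ t₁) linked-zt
      ; unique   = Unique-resp-↭ (↭-sym moved) (unique w)
      ; closing  = inj₂ y∼u
      ; root     = trans (sym (trans (cong (lastOr (z w)) t≡) (lastOr-++ t₁))) (root w)
      ; 2≤size   = ≤-trans (2≤size w) (≤-reflexive (sym same))
      }

  grown : ∀ w w′ k → size w < size w′ → n < size w + suc k → n < size w′ + k
  grown w w′ k lt big = ≤-trans big (≤-trans (≤-reflexive (+-suc (size w) k)) (+-monoˡ-≤ k lt))

  -- The recursive calls refute every better lasso, which is all that `improve` asks for. `f₁`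
  -- bounds the growth still possible, `f₂` the length of the tail.
  search : ∀ f₁ f₂ w → n < size w + f₁ → length (t w) ≤ f₂ → (∀ w → Closed w → ⊥) → ⊥
  search zero     f₂ w big _ found = n≮n n
      (≤-trans big (≤-trans (≤-reflexive (+-identityʳ _)) (Unique⇒length≤ (unique w))))
  search (suc f₁) zero w big tail found = found w (improve w
    (λ w′ lt → search f₁ (length (t w′)) w′ (grown w w′ f₁ lt big) ≤-refl found)
    (λ w′ eq lt → n≮0 (≤-trans lt tail)))
  search (suc f₁) (suc f₂) w big tail found = found w (improve w
    (λ w′ lt → search f₁ (length (t w′)) w′ (grown w w′ f₁ lt big) ≤-refl found)
    (λ w′ eq lt → search (suc f₁) f₂ w′ (subst (λ k → n < k + suc f₁) eq big) (s≤s⁻¹ (≤-trans lt tail)) found))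

-- `neighbour` is recorded because after deletions the degree bounds hold only at vertices that
-- still have an edge.
record DeadEnd {n : ℕ} (A : Adjacency n) (r : Fin n) : Set where
  open Adjacency A
  field
    {x}         : Fin n
    {c}         : List (Fin n)
    cyc         : IsCycle x c
    closed-ends : ClosedEnds x c
    not-root    : ∀ {v} → v ∈ x ∷ c → v ≢ lastOr x c → v ≢ r
    neighbour   : ∀ {v} → v ∈ x ∷ c → ∃ (v ∼_)

module _ {n : ℕ} (A : Adjacency n) where

  open Adjacency A

  ∑∣∼∣≤length : ∀ v l → ∑ l ∣ v ∼∣ ≤ length l
  ∑∣∼∣≤length v l = ≤-trans (∑-mono l λ u _ → ⟦⟧≤1 (adj v u))
                            (≤-reflexive (trans (∑-const l 1) (*-identityʳ _)))

  degree≤tail : ∀ {x c} → (∀ u → x ∼ u → u ∈ x ∷ c) → degree x ≤ length c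
  degree≤tail {x} {c} closed = ≤-trans (degree≤within closed)
    (≤-trans (≤-reflexive (cong (_+ ∑ c ∣ x ∼∣) (∣∼∣-no ∼-irr))) (∑∣∼∣≤length x c))

  -- The degree bound makes the cycle long enough: its end `x` is not the root, and all neighbours
  -- of `x` lie on the cycle.
  dead-end : ∀ {r x₁} → x₁ ∼ r → (∀ v → v ≢ r → ∃ (v ∼_) → 2 ≤ degree v) → (DeadEnd A r → ⊥) → ⊥
  dead-end {r} {x₁} x₁∼r 2≤degree found = search (suc n) 1 initial (m≤n⇒m≤o+n 2 ≤-refl) ≤-refl λ w closed →
      found (build w closed)
    where
    open Search A r
    initial : Lasso
    initial = record
      { x = x₁ ; z = x₁ ; c = [] ; t = r ∷ []
      ; last-c = refl ; linked-c = [-] ; linked-t = x₁∼r ∷ [-]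
      ; unique = (∼⇒≢ x₁∼r ∷ []) ∷ [] ∷ [] ; closing = inj₁ refl ; root = refl ; 2≤size = ≤-refl }
    build : ∀ w → Closed w → DeadEnd A r
    build record { c = [] ; t = [] ; 2≤size = s≤s () }
    build record { x = x ; c = [] ; t = h ∷ t ; last-c = refl ; linked-t = x∼h ∷ _ } closed
      with closed (record { perm = ↭-refl ; linked = [-] ; end = refl }) h x∼h
    ... | here refl = ⊥-elim (∼-irr x∼h)
    build record { closing = inj₁ () ; c = _ ∷ _ }
    build record { x = x ; z = z ; c = h ∷ c ; t = t ; last-c = refl ; linked-c = linked ; unique = unique ;
        closing = inj₂ x∼z ; root = root } closed =
      record { cyc = cyc ; closed-ends = closed ; not-root = not-root t unique root ; neighbour = neighbour }
      where
      not-root : ∀ t → Unique (x ∷ h ∷ c ++ t) → lastOr z t ≡ r → ∀ {v} → v ∈ x ∷ h ∷ c → v ≢ z → v ≢ r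
      not-root []      _ refl v∈ v≢z = v≢z
      not-root (e ∷ t) u refl v∈ v≢z refl = Unique-++-disjoint (x ∷ h ∷ c) u v∈ (lastOr-∈ e t)
      x≢r : x ≢ r
      x≢r = not-root t unique root (here refl) (∼⇒≢ x∼z)
      cyc : IsCycle x (h ∷ c)
      cyc = record
        { linked = linked ; unique = Unique-++⁻ˡ (x ∷ h ∷ c) unique ; closing = x∼z
        ; long = s≤s (≤-trans (2≤degree x x≢r (_ , x∼z))
            (degree≤tail (closed (record { perm = ↭-refl ; linked = linked ; end = refl })))) }
      neighbour : ∀ {v} → v ∈ x ∷ h ∷ c → ∃ (v ∼_)
      neighbour {v} v∈ with v ≟ z
      ... | yes refl = x , ∼-sym x∼z
      ... | no v≢z   = successor linked v∈ v≢z

-- Small sets separated by a single gate vertex.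

record Piece {n : ℕ} (A : Adjacency n) (r : Fin n) : Set where
  open Adjacency A
  field
    g           : Fin n
    S           : List (Fin n)
    unique      : Unique (g ∷ S)
    closed      : ∀ {v u} → v ∈ S → v ∼ u → u ∈ g ∷ S
    8≤size      : 8 ≤ length S
    size≤10     : length S ≤ 10
    gate-degree : degree-within S g + 6 * length S ≤ 62
    root∉       : r ∉ S
    neighbour   : ∀ {v} → v ∈ g ∷ S → ∃ (v ∼_)

module _ {n : ℕ} (A : Adjacency n) (few : Adjacency.FewChords A) where

  open Adjacency A

  piece : ∀ {r x₁} → x₁ ∼ r → (∀ v → v ≢ r → ∃ (v ∼_) → 8 ≤ degree v) → (Piece A r → ⊥) → ⊥
  piece {r} x₁∼r 8≤degree found = dead-end A x₁∼r (λ v v≢r nb → ≤-trans (s≤s (s≤s z≤n)) (8≤degree v v≢r nb))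
      (found ∘ build)
    where
    build : DeadEnd A r → Piece A r
    build D = go c refl
      where
      open DeadEnd D renaming (neighbour to cycle-neighbour)
      module P = Pocket A few cyc closed-ends
      deg : ∀ {v} → v ∈ x ∷ c → v ≢ P.z → 8 ≤ degree v
      deg v∈ v≢z = 8≤degree _ (not-root v∈ v≢z) (cycle-neighbour v∈)
      inner : ∀ {v} → v ∈ x ∷ c → v ≢ P.z → P.Inner v
      inner = P.every-inner λ v∈ i → deg v∈ (proj₁ i)
      go : ∀ c′ → c ≡ c′ → Piece A r
      go [] eq = ⊥-elim (∼-irr (subst (x ∼_) (cong (lastOr x) eq) (IsCycle.closing cyc)))
      go (h ∷ m) eq with split-last x h m
      ... | k , a , xc≡ = record
        { g = z ; S = S
        ; unique = uzS
        ; closed = λ v∈ v∼u → ∈-resp-↭ c↭ (proj₂ (S-inner v∈) _ v∼u)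
        ; 8≤size = 8≤s
        ; size≤10 = ≮⇒≥ λ lt → farkas (length S ∷ degree-within S z ∷ [])
            ((1 , var (# 1) ⊕ 6 ⊛ var (# 0) , con 62) ∷ (6 , con 11 , var (# 0)) ∷ []) (gate ∷ lt ∷ [])
        ; gate-degree = gate
        ; root∉ = λ r∈ → not-root (S⊆ r∈) (z≢ r∈ ∘ sym) refl
        ; neighbour = λ v∈ → cycle-neighbour (∈-resp-↭ (↭-sym c↭) v∈) }
        where
        z = P.z
        S = k ++ [ a ]
        c↭ : x ∷ c ↭ z ∷ S
        c↭ = ↭-trans (Perm.↭-reflexive (trans (cong (x ∷_) eq) (trans xc≡
               (trans (cong (λ e → k ++ a ∷ e ∷ []) (sym (cong (lastOr x) eq)))
                   (sym (++-assoc k [ a ] [ z ]))))))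
               (↭-trans (shift z S []) (Perm.↭-reflexive (cong (z ∷_) (++-identityʳ S))))
        uzS : Unique (z ∷ S)
        uzS = Unique-resp-↭ c↭ (IsCycle.unique cyc)
        S⊆ : ∀ {v} → v ∈ S → v ∈ x ∷ c
        S⊆ v∈ = ∈-resp-↭ (↭-sym c↭) (there v∈)
        z≢ : ∀ {v} → v ∈ S → z ≢ v
        z≢ v∈ z≡v with uzS
        ... | z∉ ∷ _ = All.lookup z∉ v∈ z≡v
        S-inner : ∀ {v} → v ∈ S → P.Inner v
        S-inner v∈ = inner (S⊆ v∈) (z≢ v∈ ∘ sym)
        length-c : length c ≡ length S
        length-c = suc-injective (↭-length c↭)
        8≤s : 8 ≤ length S
        8≤s = ≤-trans (deg (here refl) (∼⇒≢ (IsCycle.closing cyc)))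
          (≤-trans (degree≤tail A (closed-ends P.full)) (≤-reflexive length-c))
        inner-sum : 8 * length S ≤ ∑ S P.dc
        inner-sum = ≤-trans (≤-reflexive (trans (*-comm 8 (length S)) (sym (∑-const S 8))))
          (∑-mono S λ v v∈ → ≤-trans (deg (S⊆ v∈) (z≢ v∈ ∘ sym)) (P.inner-degree (S-inner v∈)))
        total : degree-within S z + ∑ S P.dc ≤ 60 + 2 * (1 + length S)
        total = begin
          degree-within S z + ∑ S P.dc     ≡⟨ cong (_+ ∑ S P.dc)
              (sym (trans (∑-↭ ∣ z ∼∣ c↭) (cong (_+ ∑ S ∣ z ∼∣) (∣∼∣-no ∼-irr)))) ⟩
          ∑ (z ∷ S) P.dc                   ≡⟨ sym (∑-↭ P.dc c↭) ⟩
          ∑ (x ∷ c) P.dc                   ≤⟨ few {x} {c} cyc ⟩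
          60 + 2 * (1 + length c)          ≡⟨ cong (λ l → 60 + 2 * (1 + l)) {length c} {length S} length-c ⟩
          60 + 2 * (1 + length S)          ∎
          where open ≤-Reasoning
        -- The degrees in `S` are at least 8, so `8 * length S` plus the degree of `z` is at most
        -- `60 + 2 * (1 + length S)`.
        gate : degree-within S z + 6 * length S ≤ 62
        gate = ≮⇒≥ λ lt → farkas (length S ∷ degree-within S z ∷ ∑ S P.dc ∷ [])
          ( (1 , 8 ⊛ s , w) ∷ (1 , f ⊕ w , con 60 ⊕ 2 ⊛ (con 1 ⊕ s)) ∷ (1 , con 63 , f ⊕ 6 ⊛ s) ∷ [])
          (inner-sum ∷ total ∷ lt ∷ [])
          where
          s = var (# 0) ; f = var (# 1) ; w = var (# 2)

-- Deletion of vertices, and counting around a dead-end cycle.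

module _ {n : ℕ} where

  -- The vertices of `X` stay as isolated ones, so that the type `Fin n` does not change.
  delete : Adjacency n → List (Fin n) → Adjacency n
  delete A X = record
    { adj     = λ u v → adj u v ∧ (kept u ∧ kept v)
    ; adj-sym = λ u v → cong₂ _∧_ (adj-sym u v) (Bool.∧-comm (kept u) (kept v))
    ; adj-irr = λ v → cong (_∧ (kept v ∧ kept v)) (adj-irr v)
    }
    where
    open Adjacency A
    kept : Fin n → Bool
    kept u = not (does (u ∈? X))

  module _ (A : Adjacency n) (X : List (Fin n)) where
    open Adjacency A
    private
      module D = Adjacency (delete A X)

    delete-∼⁻ : ∀ {u v} → u D.∼ v → u ∼ v × u ∉ X × v ∉ X
    delete-∼⁻ {u} {v} e with adj u v in uv | u ∈? X | v ∈? X
    ... | true | no u∉ | no v∉ = refl , u∉ , v∉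

    delete-∣∼∣≤ : ∀ u v → D.∣ u ∼∣ v ≤ ∣ u ∼∣ v
    delete-∣∼∣≤ u v with adj u v
    ... | true  = ⟦⟧≤1 _
    ... | false = z≤n

    delete-cycle : ∀ {x c} → D.IsCycle x c → IsCycle x c
    delete-cycle cyc = record
      { linked = Linked.map (proj₁ ∘ delete-∼⁻) linked ; unique = unique
      ; closing = proj₁ (delete-∼⁻ closing) ; long = long }
      where open D.IsCycle cyc

    delete-few : FewChords → D.FewChords
    delete-few few {x} {c} cyc = ≤-trans
      (∑-mono (x ∷ c) λ u _ → ∑-mono (x ∷ c) λ v _ → delete-∣∼∣≤ u v) (few {x} {c} (delete-cycle cyc))

    degree≤delete : ∀ {v} → v ∉ X → degree v ≤ D.degree v + degree-within X v
    degree≤delete {v} v∉ = begin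
      degree v                                        ≤⟨ ∑-mono (allFin n) (λ u _ → local u) ⟩
      ∑ (allFin n) (λ u → D.∣ v ∼∣ u + w u)           ≡⟨ ∑-+ (allFin n) D.∣ v ∼∣ w ⟩
      D.degree v + ∑ (allFin n) w                     ≤⟨ +-monoʳ-≤ (D.degree v)
          (≤-trans (∑-⊆ w (allFin⁺ n) λ u _ → only u) (∑-mono X λ u _ → w≤ u)) ⟩
      D.degree v + degree-within X v                  ∎
      where
      open ≤-Reasoning
      w : Fin n → ℕ
      w u = ⟦ does (u ∈? X) ⟧ * ∣ v ∼∣ u
      w≤ : ∀ u → w u ≤ ∣ v ∼∣ u
      w≤ u = ≤-trans (*-monoˡ-≤ (∣ v ∼∣ u) (⟦⟧≤1 (does (u ∈? X)))) (≤-reflexive (*-identityˡ _))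
      only : ∀ u → w u ≡ 0 ⊎ u ∈ X
      only u with u ∈? X
      ... | yes u∈ = inj₂ u∈
      ... | no _   = inj₁ refl
      local : ∀ u → ∣ v ∼∣ u ≤ D.∣ v ∼∣ u + w u
      local u with u ∈? X | v ∈? X | adj v u
      ... | yes _ | _      | true  = m≤n+m 1 _
      ... | no _  | no _   | true  = s≤s z≤n
      ... | no _  | yes v∈ | true  = ⊥-elim (v∉ v∈)
      ... | _     | _      | false = z≤n

  module _ (A : Adjacency n) where

    open Adjacency A

    nonadjacent-within : ∀ {v X} → (∀ u → u ∈ X → ¬ v ∼ u) → degree-within X v ≡ 0
    nonadjacent-within {v} {X} non = ∑-0 X λ u u∈ → ∣∼∣-no (non u u∈)

    ∃neighbour : ∀ {v} → 1 ≤ degree v → ∃ (v ∼_)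
    ∃neighbour {v} 1≤d with any? (v ∼?_)
    ... | yes e = e
    ... | no ¬e = ⊥-elim (n≮0 (≤-trans 1≤d
        (≤-reflexive (nonadjacent-within {X = allFin n} λ u _ v∼u → ¬e (u , v∼u)))))

    -- Adjacencies from `K` that leave the cycle end in `X`, and there are at most `∑ X degree` of
    -- them.
    cycle-balance : FewChords → ∀ {x c} → IsCycle x c → ∀ K X → Unique K → (∀ {v} → v ∈ K → v ∈ x ∷ c) →
      (∀ {v} → v ∈ x ∷ c → v ∈ K) → (∀ {u v} → u ∼ v → v ∈ x ∷ c ⊎ v ∈ X) → Unique X →
      ∑ K degree ≤ 60 + 2 * length K + ∑ X degree
    cycle-balance few {x} {c} cyc K X uK K⊆ ⊆K cover uX = begin
      ∑ K degree
        ≤⟨ ∑-mono K (λ u _ → degree≤within {l = (x ∷ c) ++ X} λ v u∼v → [ ∈-++⁺ˡ , ∈-++⁺ʳ (x ∷ c) ]′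
            (cover u∼v)) ⟩
      ∑ K (degree-within ((x ∷ c) ++ X))
        ≡⟨ trans (∑-cong K λ u _ → ∑-++ (x ∷ c) X ∣ u ∼∣) (∑-+ K (degree-within (x ∷ c)) (degree-within X)) ⟩
      ∑ K (degree-within (x ∷ c)) + ∑ K (degree-within X)
        ≤⟨ +-mono-≤ (≤-trans (∑-⊆ _ uK λ v v∈ → inj₂ (K⊆ v∈)) (few {x} {c} cyc)) outside ⟩
      60 + 2 * length (x ∷ c) + ∑ X degree
        ≤⟨ +-monoˡ-≤ _ (+-monoʳ-≤ 60 (*-monoʳ-≤ 2 (⊆⇒length≤ (IsCycle.unique cyc) λ v → ⊆K))) ⟩
      60 + 2 * length K + ∑ X degree ∎
      where
      open ≤-Reasoning
      outside : ∑ K (degree-within X) ≤ ∑ X degree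
      outside = begin
        ∑ K (λ u → ∑ X ∣ u ∼∣)              ≡⟨ ∑-swap K X (λ u v → ∣ u ∼∣ v) ⟩
        ∑ X (λ v → ∑ K (λ u → ∣ u ∼∣ v))    ≡⟨ ∑-cong X (λ v _ → ∑-cong K λ u _ → ∣∼∣-sym u v) ⟩
        ∑ X (degree-within K)               ≤⟨ ∑-mono X (λ v _ → within≤degree uK) ⟩
        ∑ X degree                          ∎

  module _ (A : Adjacency n) (few : Adjacency.FewChords A) {r} (D : DeadEnd A r) where

    open Adjacency A
    open DeadEnd D
    open Pocket A few cyc closed-ends using
        (S; s; s≤1; s-outer; Inner; inner?; Trav; full; end-inner; rotate-heads; s-inner; end-degree≤S)

    private
      l : List (Fin n)
      l = x ∷ c

    -- The neighbours of `v`, the inner vertices and `v` itself are disjoint parts of `W`, because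
    -- an inner vertex has no neighbour off the cycle.
    outside-degree : ∀ W → (∀ {u v} → u ∼ v → u ∈ W) → ∀ {v} → v ∈ W → v ∉ l → degree v + S + 1 ≤ length W
    outside-degree W cover {v} v∈W v∉l = begin
      degree v + S + 1
        ≤⟨ +-mono-≤ (+-mono-≤ (degree≤within λ u v∼u → cover (∼-sym v∼u)) S≤) (1≤∑indicator v∈W) ⟩
      ∑ W ∣ v ∼∣ + ∑ W on-cycle + ∑ W (indicator v)
        ≡⟨ sym (trans (∑-+ W (λ u → ∣ v ∼∣ u + on-cycle u) (indicator v))
            (cong (_+ ∑ W (indicator v)) (∑-+ W ∣ v ∼∣ on-cycle))) ⟩
      ∑ W (λ u → ∣ v ∼∣ u + on-cycle u + indicator v u)
        ≤⟨ ∑-mono W (λ u _ → local u) ⟩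
      ∑ W (const 1)
        ≡⟨ trans (∑-const W 1) (*-identityʳ _) ⟩
      length W ∎
      where
      open ≤-Reasoning
      on-cycle : Fin n → ℕ
      on-cycle u = ⟦ does (u ∈? l) ⟧ * s u
      on : ∀ {u} → u ∈ l → on-cycle u ≡ s u
      on {u} u∈ = trans (cong (λ b → ⟦ b ⟧ * s u) (dec-true (u ∈? l) u∈)) (*-identityˡ (s u))
      off : ∀ {u} → u ∉ l → on-cycle u ≡ 0
      off {u} u∉ = cong (λ b → ⟦ b ⟧ * s u) (dec-false (u ∈? l) u∉)
      S≤ : S ≤ ∑ W on-cycle
      S≤ = ≤-trans (≤-reflexive (∑-cong l λ u u∈ → sym (on u∈)))
                   (∑-⊆ on-cycle (IsCycle.unique cyc) λ u u∈ → inj₂ (cover (proj₂ (neighbour u∈))))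
      ∼+on≤1 : ∀ u → ∣ v ∼∣ u + on-cycle u ≤ 1
      ∼+on≤1 u with toSum (u ∈? l)
      ... | inj₂ u∉ rewrite off u∉ | +-identityʳ (∣ v ∼∣ u) = ⟦⟧≤1 (adj v u)
      ... | inj₁ u∈ rewrite on u∈ with toSum (inner? u)
      ...   | inj₁ i = ≤-trans (≤-reflexive (cong (_+ s u) (∣∼∣-no (λ v∼u → v∉l (proj₂ i v (∼-sym v∼u))))))
          (s≤1 u)
      ...   | inj₂ ¬i = ≤-trans (≤-reflexive (trans (cong (∣ v ∼∣ u +_) (s-outer ¬i)) (+-identityʳ _)))
          (⟦⟧≤1 (adj v u))
      local : ∀ u → ∣ v ∼∣ u + on-cycle u + indicator v u ≤ 1
      local u with toSum (v ≟ u)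
      ... | inj₁ refl = ≤-reflexive (cong₂ _+_ (cong₂ _+_ (∣∼∣-no ∼-irr) (off v∉l)) (indicator-refl v))
      ... | inj₂ v≢u  = ≤-trans (≤-reflexive
          (trans (cong (∣ v ∼∣ u + on-cycle u +_) (indicator-≢ v≢u)) (+-identityʳ _))) (∼+on≤1 u)

    -- A neighbour of `x` other than the second vertex of the cycle has a predecessor different from
    -- `x`, and rotation makes that an end.
    second-end : 2 ≤ degree x → ∃₂ λ y q → Trav (y ∷ q) × x ≢ y
    second-end 2≤d = go c refl
      where
      snoc : ∀ (h : Fin n) m → ∃ λ k → h ∷ m ≡ k ++ [ lastOr h m ]
      snoc h []      = [] , refl
      snoc h (i ∷ m) with snoc i m
      ... | k , eq = h ∷ k , cong (h ∷_) eq
      2≤c : 2 ≤ ∑ c ∣ x ∼∣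
      2≤c = ≤-trans 2≤d (≤-trans (degree≤within (closed-ends full))
          (≤-reflexive (cong (_+ ∑ c ∣ x ∼∣) (∣∼∣-no ∼-irr))))
      go : ∀ c′ → c ≡ c′ → ∃₂ λ y q → Trav (y ∷ q) × x ≢ y
      go []      eq = ⊥-elim (n≮0 (≤-trans 2≤c (≤-reflexive (cong (λ d → ∑ d ∣ x ∼∣) eq))))
      go (h ∷ m) eq with any-neighbour m
          (≤-trans 2≤c (≤-trans (≤-reflexive (cong (λ d → ∑ d ∣ x ∼∣) eq)) (+-monoˡ-≤ _ (⟦⟧≤1 (adj x h)))))
        where
        any-neighbour : ∀ m → 2 ≤ 1 + ∑ m ∣ x ∼∣ → ∃ λ w → w ∈ m × x ∼ w
        any-neighbour []      (s≤s ())
        any-neighbour (w ∷ m) 2≤ with x ∼? w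
        ... | yes x∼w = w , here refl , x∼w
        ... | no x≁w with any-neighbour m (subst (λ k → 2 ≤ 1 + (k + ∑ m ∣ x ∼∣)) (∣∼∣-no x≁w) 2≤)
        ...   | w′ , w∈ , x∼w = w′ , there w∈ , x∼w
      ... | w , w∈m , x∼w with ∈-∃++ w∈m
      ...   | m₁ , m₂ , m≡ with snoc h m₁
      ...     | k , hm≡ = a , _ , rotate (x ∷ k) full at x∼w , x≢a
        where
        a = lastOr h m₁
        at : x ∷ c ≡ (x ∷ k) ++ a ∷ w ∷ m₂
        at = cong (x ∷_) (trans eq (trans (cong (h ∷_) m≡)
            (trans (cong (_++ w ∷ m₂) hm≡) (++-assoc k [ a ] (w ∷ m₂)))))
        x≢a : x ≢ a
        x≢a with subst Unique at (IsCycle.unique cyc)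
        ... | x∉ ∷ _ = All.lookup x∉ (∈-++⁺ʳ k (here refl))

-- The vertices that remain after two removals.

module _ {n : ℕ} (A : Adjacency n) where

  open Adjacency A

  -- A cycle on `h` vertices with inner degree 8 has `3 * h` chords, more than 30 only from 11 on.
  -- For 9 and 10 the degrees of `g₁` and `g₂` have to make up the difference.
  module Remainder (few : FewChords)
    {g₁ g₂ : Fin n} {N : List (Fin n)} (unique : Unique (g₁ ∷ g₂ ∷ N))
    (support : ∀ {u v} → u ∼ v → u ∈ g₁ ∷ g₂ ∷ N) (8≤degree : ∀ {v} → v ∈ N → 8 ≤ degree v)
    (9≤N : 9 ≤ length N) (N≤13 : length N ≤ 13) (g₂≤g₁ : degree g₂ ≤ degree g₁)
    (when-9 : length N ≡ 9 → 4 ≤ degree g₂ × 12 ≤ degree g₁ + degree g₂)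
    (when-10 : length N ≡ 10 → 6 ≤ degree g₁)
    where

    h D₁ D₂ : ℕ
    h  = length N
    D₁ = degree g₁
    D₂ = degree g₂

    small : (h ≡ 9 × 4 ≤ D₂ × 12 ≤ D₁ + D₂) ⊎ (h ≡ 10 × 6 ≤ D₁) ⊎ 11 ≤ h
    small with h Data.Nat.≟ 9 | h Data.Nat.≟ 10
    ... | yes e | _     = inj₁ (e , when-9 e)
    ... | no _  | yes e = inj₂ (inj₁ (e , when-10 e))
    ... | no ¬9 | no ¬10 = inj₂ (inj₂ (≤∧≢⇒< (≤∧≢⇒< 9≤N (¬9 ∘ sym)) (¬10 ∘ sym)))

    uN : Unique N
    uN = AllPairs.tail (AllPairs.tail unique)

    u₂N : Unique (g₂ ∷ N)
    u₂N = AllPairs.tail unique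

    u₁N : Unique (g₁ ∷ N)
    u₁N = All.tail (AllPairs.head unique) ∷ uN

    g₁≢g₂ : g₁ ≢ g₂
    g₁≢g₂ = All.head (AllPairs.head unique)

    8h≤ : 8 * h ≤ ∑ N degree
    8h≤ = ≤-trans (≤-reflexive (trans (*-comm 8 h) (sym (∑-const N 8)))) (∑-mono N λ v v∈ → 8≤degree v∈)

    vh v₁ v₂ vΣ : Linear 4
    vh = var (# 0) ; v₁ = var (# 1) ; v₂ = var (# 2) ; vΣ = var (# 3)

    ρ : Vec ℕ 4
    ρ = h ∷ D₁ ∷ D₂ ∷ ∑ N degree ∷ []

    module _ {x c} (cyc : IsCycle x c) (N⊆ : ∀ {v} → v ∈ N → v ∈ x ∷ c)
        (⊆W : ∀ {v} → v ∈ x ∷ c → v ∈ g₁ ∷ g₂ ∷ N) where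

      balance-both : g₁ ∈ x ∷ c → g₂ ∈ x ∷ c → 8 * h + D₁ + D₂ ≤ 64 + 2 * h
      balance-both g₁∈ g₂∈ = ≮⇒≥ λ lt → farkas ρ
        ( (1 , v₁ ⊕ (v₂ ⊕ vΣ) , con 60 ⊕ 2 ⊛ (con 1 ⊕ (con 1 ⊕ vh)) ⊕ con 0)
        ∷ (1 , 8 ⊛ vh , vΣ) ∷ (1 , con 1 ⊕ (con 64 ⊕ 2 ⊛ vh) , 8 ⊛ vh ⊕ v₁ ⊕ v₂) ∷ [])
        (cycle-balance A few cyc (g₁ ∷ g₂ ∷ N) [] unique
          (λ { (here refl) → g₁∈ ; (there (here refl)) → g₂∈ ; (there (there v∈)) → N⊆ v∈ }) ⊆W
          (λ u∼v → inj₁ (on (support (∼-sym u∼v)))) [] ∷ 8h≤ ∷ lt ∷ [])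
        where
        on : ∀ {v} → v ∈ g₁ ∷ g₂ ∷ N → v ∈ x ∷ c
        on (here refl)         = g₁∈
        on (there (here refl)) = g₂∈
        on (there (there v∈))  = N⊆ v∈

      balance₁ : g₁ ∈ x ∷ c → g₂ ∉ x ∷ c → 8 * h + D₁ ≤ 62 + 2 * h + D₂
      balance₁ g₁∈ g₂∉ = ≮⇒≥ λ lt → farkas ρ
        ( (1 , v₁ ⊕ vΣ , con 60 ⊕ 2 ⊛ (con 1 ⊕ vh) ⊕ (v₂ ⊕ con 0))
        ∷ (1 , 8 ⊛ vh , vΣ) ∷ (1 , con 1 ⊕ (con 62 ⊕ 2 ⊛ vh ⊕ v₂) , 8 ⊛ vh ⊕ v₁) ∷ [])
        (cycle-balance A few cyc (g₁ ∷ N) [ g₂ ] u₁N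
          (λ { (here refl) → g₁∈ ; (there v∈) → N⊆ v∈ }) (λ v∈ → in-K v∈ (⊆W v∈))
          (λ u∼v → on (support (∼-sym u∼v))) ([] ∷ []) ∷ 8h≤ ∷ lt ∷ [])
        where
        in-K : ∀ {v} → v ∈ x ∷ c → v ∈ g₁ ∷ g₂ ∷ N → v ∈ g₁ ∷ N
        in-K _ (here refl)          = here refl
        in-K v∈ (there (here refl)) = ⊥-elim (g₂∉ v∈)
        in-K _ (there (there v∈))   = there v∈
        on : ∀ {v} → v ∈ g₁ ∷ g₂ ∷ N → v ∈ x ∷ c ⊎ v ∈ [ g₂ ]
        on (here refl)         = inj₁ g₁∈
        on (there (here refl)) = inj₂ (here refl)
        on (there (there v∈))  = inj₁ (N⊆ v∈)

      balance₂ : g₁ ∉ x ∷ c → g₂ ∈ x ∷ c → 8 * h + D₂ ≤ 62 + 2 * h + D₁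
      balance₂ g₁∉ g₂∈ = ≮⇒≥ λ lt → farkas ρ
        ( (1 , v₂ ⊕ vΣ , con 60 ⊕ 2 ⊛ (con 1 ⊕ vh) ⊕ (v₁ ⊕ con 0))
        ∷ (1 , 8 ⊛ vh , vΣ) ∷ (1 , con 1 ⊕ (con 62 ⊕ 2 ⊛ vh ⊕ v₁) , 8 ⊛ vh ⊕ v₂) ∷ [])
        (cycle-balance A few cyc (g₂ ∷ N) [ g₁ ] u₂N
          (λ { (here refl) → g₂∈ ; (there v∈) → N⊆ v∈ }) (λ v∈ → in-K v∈ (⊆W v∈))
          (λ u∼v → on (support (∼-sym u∼v))) ([] ∷ []) ∷ 8h≤ ∷ lt ∷ [])
        where
        in-K : ∀ {v} → v ∈ x ∷ c → v ∈ g₁ ∷ g₂ ∷ N → v ∈ g₂ ∷ N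
        in-K v∈ (here refl)         = ⊥-elim (g₁∉ v∈)
        in-K _ (there v∈)           = v∈
        on : ∀ {v} → v ∈ g₁ ∷ g₂ ∷ N → v ∈ x ∷ c ⊎ v ∈ [ g₁ ]
        on (here refl)         = inj₂ (here refl)
        on (there (here refl)) = inj₁ g₂∈
        on (there (there v∈))  = inj₁ (N⊆ v∈)

      balance-none : g₁ ∉ x ∷ c → g₂ ∉ x ∷ c → 8 * h ≤ 60 + 2 * h + (D₁ + D₂)
      balance-none g₁∉ g₂∉ = ≮⇒≥ λ lt → farkas ρ
        ( (1 , vΣ , con 60 ⊕ 2 ⊛ vh ⊕ (v₁ ⊕ (v₂ ⊕ con 0)))
        ∷ (1 , 8 ⊛ vh , vΣ) ∷ (1 , con 1 ⊕ (con 60 ⊕ 2 ⊛ vh ⊕ (v₁ ⊕ v₂)) , 8 ⊛ vh) ∷ [])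
        (cycle-balance A few cyc N (g₁ ∷ [ g₂ ]) uN N⊆ (λ v∈ → in-K v∈ (⊆W v∈))
          (λ u∼v → on (support (∼-sym u∼v))) ((g₁≢g₂ ∷ []) ∷ [] ∷ []) ∷ 8h≤ ∷ lt ∷ [])
        where
        in-K : ∀ {v} → v ∈ x ∷ c → v ∈ g₁ ∷ g₂ ∷ N → v ∈ N
        in-K v∈ (here refl)         = ⊥-elim (g₁∉ v∈)
        in-K v∈ (there (here refl)) = ⊥-elim (g₂∉ v∈)
        in-K _ (there (there v∈))   = v∈
        on : ∀ {v} → v ∈ g₁ ∷ g₂ ∷ N → v ∈ x ∷ c ⊎ v ∈ g₁ ∷ [ g₂ ]
        on (here refl)         = inj₂ (here refl)
        on (there (here refl)) = inj₂ (there (here refl))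
        on (there (there v∈))  = inj₁ (N⊆ v∈)

    -- g₁ may serve as an end of a rotated path, because it has two neighbours.
    module Rich (2≤D₁ : 2 ≤ D₁) {r} (no-g₂ : r ≢ g₂ → ¬ ∃ (g₂ ∼_)) (D : DeadEnd A r) where
      open DeadEnd D
      open Pocket A few cyc closed-ends using
          (S; z; Inner; inner?; full; end-inner; end-degree≤S; Trav; every-inner)

      W : List (Fin n)
      W = g₁ ∷ g₂ ∷ N

      in-W : ∀ {v} → v ∈ x ∷ c → v ∈ W
      in-W v∈ = support (proj₂ (neighbour v∈))

      trav-∈ : ∀ {y q} → Trav (y ∷ q) → y ∈ x ∷ c
      trav-∈ T = ∈-resp-↭ (Traversal.perm T) (here refl)

      -- No end is `g₂`, which is either the root or isolated.
      end-normal : ∀ {y q} → Trav (y ∷ q) → y ≢ g₁ → 8 ≤ S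
      end-normal {y} T y≢g₁ with in-W (trav-∈ T)
      ... | here refl         = ⊥-elim (y≢g₁ refl)
      ... | there (there y∈N) = ≤-trans (8≤degree y∈N) (end-degree≤S T)
      ... | there (here refl) = ⊥-elim
          (no-g₂ (not-root (trav-∈ T) (proj₁ (end-inner T)) ∘ sym) (neighbour (trav-∈ T)))

      8≤S : 8 ≤ S
      8≤S with x ≟ g₁
      ... | no x≢g₁ = end-normal full x≢g₁
      ... | yes refl with second-end A few D 2≤D₁
      ...   | y , q , T , x≢y = end-normal T (x≢y ∘ sym)

      outside : ∀ {v} → v ∈ W → v ∉ x ∷ c → degree v + 8 + 1 ≤ 2 + h
      outside {v} v∈ v∉ = ≤-trans (+-monoˡ-≤ 1 (+-monoʳ-≤ (degree v) 8≤S))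
          (outside-degree A few D W support v∈ v∉)

      N⊆ : ∀ {v} → v ∈ N → v ∈ x ∷ c
      N⊆ {v} v∈ with v ∈? (x ∷ c)
      ... | yes v∈c = v∈c
      -- `8 + 8 + 1` exceeds `2 + 13`.
      ... | no v∉   = ⊥-elim (farkas (h ∷ degree v ∷ [])
        ((1 , var (# 1) ⊕ con 8 ⊕ con 1 , con 2 ⊕ var (# 0)) ∷ (1 , con 8 , var (# 1)) ∷
            (1 , var (# 0) , con 13) ∷ [])
        (outside (there (there v∈)) v∉ ∷ 8≤degree v∈ ∷ N≤13 ∷ []))

      both : g₁ ∈ x ∷ c → g₂ ∈ x ∷ c → ⊥
      both g₁∈ g₂∈ with small | balance-both cyc N⊆ in-W g₁∈ g₂∈
      ... | inj₁ (h≡ , _ , sum) | b = farkas ρ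
        ((1 , 8 ⊛ vh ⊕ v₁ ⊕ v₂ , con 64 ⊕ 2 ⊛ vh) ∷ (6 , con 9 , vh) ∷ (1 , con 12 , v₁ ⊕ v₂) ∷ [])
            (b ∷ 9≤N ∷ sum ∷ [])
      ... | inj₂ (inj₁ (h≡ , 6≤)) | b = farkas ρ
        ((1 , 8 ⊛ vh ⊕ v₁ ⊕ v₂ , con 64 ⊕ 2 ⊛ vh) ∷ (6 , con 10 , vh) ∷ (1 , con 6 , v₁) ∷ [])
            (b ∷ ≤-reflexive (sym h≡) ∷ 6≤ ∷ [])
      ... | inj₂ (inj₂ 11≤h) | b = farkas ρ
        ((1 , 8 ⊛ vh ⊕ v₁ ⊕ v₂ , con 64 ⊕ 2 ⊛ vh) ∷ (6 , con 11 , vh) ∷ []) (b ∷ 11≤h ∷ [])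

      only₁ : g₁ ∈ x ∷ c → g₂ ∉ x ∷ c → ⊥
      only₁ g₁∈ g₂∉ with small | balance₁ cyc N⊆ in-W g₁∈ g₂∉ | outside (there (here refl)) g₂∉
      ... | inj₁ (h≡ , 4≤ , _) | _ | o = farkas ρ
        ((1 , v₂ ⊕ con 8 ⊕ con 1 , con 2 ⊕ vh) ∷ (1 , vh , con 9) ∷ (1 , con 4 , v₂) ∷ [])
            (o ∷ ≤-reflexive h≡ ∷ 4≤ ∷ [])
      ... | inj₂ (inj₁ (h≡ , 6≤)) | b | o = farkas ρ
        ((1 , 8 ⊛ vh ⊕ v₁ , con 62 ⊕ 2 ⊛ vh ⊕ v₂) ∷ (1 , v₂ ⊕ con 8 ⊕ con 1 , con 2 ⊕ vh) ∷
            (5 , con 10 , vh) ∷ (1 , con 6 , v₁) ∷ [])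
        (b ∷ o ∷ ≤-reflexive (sym h≡) ∷ 6≤ ∷ [])
      ... | inj₂ (inj₂ 11≤h) | b | _ = farkas ρ
        ((1 , 8 ⊛ vh ⊕ v₁ , con 62 ⊕ 2 ⊛ vh ⊕ v₂) ∷ (6 , con 11 , vh) ∷ (1 , v₂ , v₁) ∷ [])
            (b ∷ 11≤h ∷ g₂≤g₁ ∷ [])

      6≤D₁⇒h≥11 : 6 ≤ D₁ → g₁ ∉ x ∷ c → 11 ≤ h
      6≤D₁⇒h≥11 6≤ g₁∉ = ≮⇒≥ λ lt → farkas ρ
        ((1 , v₁ ⊕ con 8 ⊕ con 1 , con 2 ⊕ vh) ∷ (1 , con 1 ⊕ vh , con 11) ∷ (1 , con 6 , v₁) ∷ [])
        (outside (here refl) g₁∉ ∷ lt ∷ 6≤ ∷ [])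

      11≤h : g₁ ∉ x ∷ c → 11 ≤ h
      11≤h g₁∉ with small
      ... | inj₁ (_ , _ , sum)     = 6≤D₁⇒h≥11 (≮⇒≥ λ lt → farkas ρ
        ((2 , con 1 ⊕ v₁ , con 6) ∷ (1 , v₂ , v₁) ∷ (1 , con 12 , v₁ ⊕ v₂) ∷ []) (lt ∷ g₂≤g₁ ∷ sum ∷ [])) g₁∉
      ... | inj₂ (inj₁ (_ , 6≤))   = 6≤D₁⇒h≥11 6≤ g₁∉
      ... | inj₂ (inj₂ 11≤)        = 11≤

      -- `outside` gives `D₁ ≤ h - 7`, so the balance becomes `5 * h + D₂ ≤ 55`. At `h` equal to 11
      -- it fails only because `g₂`, being on the cycle, has a neighbour.
      only₂ : g₁ ∉ x ∷ c → g₂ ∈ x ∷ c → ⊥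
      only₂ g₁∉ g₂∈ = farkas ρ
        ((1 , 8 ⊛ vh ⊕ v₂ , con 62 ⊕ 2 ⊛ vh ⊕ v₁) ∷ (1 , v₁ ⊕ con 8 ⊕ con 1 , con 2 ⊕ vh) ∷
            (5 , con 11 , vh) ∷ (1 , con 1 , v₂) ∷ [])
        (balance₂ cyc N⊆ in-W g₁∉ g₂∈ ∷ outside (here refl) g₁∉ ∷ 11≤h g₁∉ ∷ 1≤D₂ ∷ [])
        where
        1≤D₂ : 1 ≤ D₂
        1≤D₂ with neighbour g₂∈
        ... | u , g₂∼u = ≤-trans (≤-reflexive (sym (∣∼∣-yes g₂∼u))) (term≤∑ ∣ g₂ ∼∣ (∈-allFin u))

      -- The cycle lies in `N`, so all its vertices except `z` are inner, and `g₁` and `g₂` can be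
      -- adjacent only to `z` and to each other.
      neither : g₁ ∉ x ∷ c → g₂ ∉ x ∷ c → ⊥
      neither g₁∉ g₂∉ = farkas ρ
        ((1 , 8 ⊛ vh , con 60 ⊕ 2 ⊛ vh ⊕ (v₁ ⊕ v₂)) ∷ (6 , con 11 , vh) ∷ (1 , v₁ , con 2) ∷
            (1 , v₂ , con 2) ∷ [])
        (balance-none cyc N⊆ in-W g₁∉ g₂∉ ∷ 11≤h g₁∉ ∷ gate₁ ∷ gate₂ ∷ [])
        where
        on-N : ∀ {v} → v ∈ x ∷ c → v ∈ N
        on-N v∈ with in-W v∈
        ... | here refl          = ⊥-elim (g₁∉ v∈)
        ... | there (here refl)  = ⊥-elim (g₂∉ v∈)
        ... | there (there v∈N)  = v∈N
        inner : ∀ {v} → v ∈ x ∷ c → v ≢ z → Inner v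
        inner = every-inner λ v∈ _ → 8≤degree (on-N v∈)
        meets : ∀ {g} → g ∉ x ∷ c → ∀ u → g ∼ u → u ∈ z ∷ g₁ ∷ g₂ ∷ []
        meets g∉ u g∼u with support (∼-sym g∼u)
        ... | here refl         = there (here refl)
        ... | there (here refl) = there (there (here refl))
        ... | there (there u∈N) with u ≟ z
        ...   | yes refl = here refl
        ...   | no u≢z   = ⊥-elim (g∉ (proj₂ (inner (N⊆ u∈N) u≢z) _ (∼-sym g∼u)))
        gate₁ : D₁ ≤ 2
        gate₁ = ≤-trans (degree≤within {l = z ∷ [ g₂ ]} λ u g₁∼u → drop (∼⇒≢ g₁∼u) (meets g₁∉ u g₁∼u))
            (∑∣∼∣≤length A g₁ (z ∷ [ g₂ ]))
          where
          drop : ∀ {u} → g₁ ≢ u → u ∈ z ∷ g₁ ∷ g₂ ∷ [] → u ∈ z ∷ [ g₂ ]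
          drop ≢u (here refl)                 = here refl
          drop ≢u (there (here refl))         = ⊥-elim (≢u refl)
          drop ≢u (there (there (here refl))) = there (here refl)
        gate₂ : D₂ ≤ 2
        gate₂ = ≤-trans (degree≤within {l = z ∷ [ g₁ ]} λ u g₂∼u → drop (∼⇒≢ g₂∼u) (meets g₂∉ u g₂∼u))
            (∑∣∼∣≤length A g₂ (z ∷ [ g₁ ]))
          where
          drop : ∀ {u} → g₂ ≢ u → u ∈ z ∷ g₁ ∷ g₂ ∷ [] → u ∈ z ∷ [ g₁ ]
          drop ≢u (here refl)                 = here refl
          drop ≢u (there (here refl))         = there (here refl)
          drop ≢u (there (there (here refl))) = ⊥-elim (≢u refl)

      impossible : ⊥
      impossible with g₁ ∈? (x ∷ c) | g₂ ∈? (x ∷ c)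
      ... | yes g₁∈ | yes g₂∈ = both g₁∈ g₂∈
      ... | yes g₁∈ | no g₂∉  = only₁ g₁∈ g₂∉
      ... | no g₁∉  | yes g₂∈ = only₂ g₁∉ g₂∈
      ... | no g₁∉  | no g₂∉  = neither g₁∉ g₂∉

    -- The root is `g₂` if that has an edge, and otherwise a neighbour of `g₁`.
    rich : 2 ≤ D₁ → ⊥
    rich 2≤D₁ with any? (g₂ ∼?_)
    ... | yes (x₁ , g₂∼x₁) = dead-end A (∼-sym g₂∼x₁) 2≤degree
        (Rich.impossible 2≤D₁ (λ g₂≢g₂ → ⊥-elim (g₂≢g₂ refl)))
      where
      2≤degree : ∀ v → v ≢ g₂ → ∃ (v ∼_) → 2 ≤ degree v
      2≤degree v v≢g₂ (u , v∼u) with support v∼u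
      ... | here refl         = 2≤D₁
      ... | there (here refl) = ⊥-elim (v≢g₂ refl)
      ... | there (there v∈)  = ≤-trans (s≤s (s≤s z≤n)) (8≤degree v∈)
    ... | no ¬e with ∃neighbour A (≤-trans (s≤s z≤n) 2≤D₁)
    ...   | y , g₁∼y = dead-end A g₁∼y 2≤degree (Rich.impossible 2≤D₁ (λ _ → ¬e))
      where
      2≤degree : ∀ v → v ≢ y → ∃ (v ∼_) → 2 ≤ degree v
      2≤degree v _ (u , v∼u) with support v∼u
      ... | here refl         = 2≤D₁
      ... | there (here refl) = ⊥-elim (¬e (u , v∼u))
      ... | there (there v∈)  = ≤-trans (s≤s (s≤s z≤n)) (8≤degree v∈)

    -- A vertex of degree 1 would violate the bound in `dead-end`, so the edges at `g₁` are deleted.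
    -- Other degrees drop by at most 1, and `7 + 7 + 1` still exceeds `1 + 13`; the chords are
    -- counted in `A`, with degree 8.
    module Poor (D₁≤1 : D₁ ≤ 1) where

      A′ : Adjacency n
      A′ = delete A [ g₁ ]
      module A′ = Adjacency A′

      few′ : A′.FewChords
      few′ = delete-few A [ g₁ ] few

      support′ : ∀ {u v} → u A′.∼ v → u ∈ g₂ ∷ N
      support′ u∼v with delete-∼⁻ A [ g₁ ] u∼v
      ... | u∼v′ , u∉ , _ with support u∼v′
      ...   | here refl = ⊥-elim (u∉ (here refl))
      ...   | there u∈  = u∈

      7≤degree : ∀ {v} → v ∈ N → 7 ≤ A′.degree v
      7≤degree {v} v∈ = ≮⇒≥ λ lt → farkas (degree v ∷ A′.degree v ∷ degree-within [ g₁ ] v ∷ [])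
        ((1 , con 8 , var (# 0)) ∷ (1 , var (# 0) , var (# 1) ⊕ var (# 2)) ∷ (1 , var (# 2) , con 1) ∷
            (1 , con 1 ⊕ var (# 1) , con 7) ∷ [])
        (8≤degree v∈ ∷ degree≤delete A [ g₁ ] v∉ ∷ ∑∣∼∣≤length A v [ g₁ ] ∷ lt ∷ [])
        where
        v∉ : v ∉ [ g₁ ]
        v∉ (here refl) = Unique[x∷xs]⇒x∉xs u₁N v∈

      11≤h : 11 ≤ h
      11≤h with small
      ... | inj₁ (_ , _ , sum)   = ⊥-elim
          (farkas ρ ((2 , v₁ , con 1) ∷ (1 , v₂ , v₁) ∷ (1 , con 12 , v₁ ⊕ v₂) ∷ []) (D₁≤1 ∷ g₂≤g₁ ∷ sum ∷ []))
      ... | inj₂ (inj₁ (_ , 6≤)) = ⊥-elim (farkas ρ ((1 , con 6 , v₁) ∷ (1 , v₁ , con 1) ∷ []) (6≤ ∷ D₁≤1 ∷ []))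
      ... | inj₂ (inj₂ 11≤)      = 11≤

      blocked : ∀ {r} → (r ≢ g₂ → ¬ ∃ (g₂ A′.∼_)) → DeadEnd A′ r → ⊥
      blocked {r} no-g₂ D = finish
        where
        open DeadEnd D
        open Pocket A′ few′ cyc closed-ends using (S; full; end-inner; end-degree≤S)
        7≤S : 7 ≤ S
        7≤S with support′ (proj₂ (neighbour (here refl)))
        ... | there x∈N = ≤-trans (7≤degree x∈N) (end-degree≤S full)
        ... | here refl = ⊥-elim (no-g₂ (not-root (here refl) (proj₁ (end-inner full)) ∘ sym)
            (neighbour (here refl)))
        N⊆ : ∀ {v} → v ∈ N → v ∈ x ∷ c
        N⊆ {v} v∈ with v ∈? (x ∷ c)
        ... | yes v∈c = v∈c
        ... | no v∉   = ⊥-elim (farkas (h ∷ A′.degree v ∷ S ∷ [])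
          ((1 , var (# 1) ⊕ var (# 2) ⊕ con 1 , con 1 ⊕ var (# 0)) ∷ (1 , con 7 , var (# 1)) ∷
              (1 , con 7 , var (# 2)) ∷ (1 , var (# 0) , con 13) ∷ [])
          (outside-degree A′ few′ D (g₂ ∷ N) support′ (there v∈) v∉ ∷ 7≤degree v∈ ∷ 7≤S ∷ N≤13 ∷ []))
        g₁∉ : g₁ ∉ x ∷ c
        g₁∉ g₁∈ = proj₁ (proj₂ (delete-∼⁻ A [ g₁ ] (proj₂ (neighbour g₁∈)))) (here refl)
        in-W : ∀ {v} → v ∈ x ∷ c → v ∈ g₁ ∷ g₂ ∷ N
        in-W v∈ = there (support′ (proj₂ (neighbour v∈)))
        cycA : IsCycle x c
        cycA = delete-cycle A [ g₁ ] cyc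
        finish : ⊥
        finish with g₂ ∈? (x ∷ c)
        ... | yes g₂∈ = farkas ρ ((1 , 8 ⊛ vh ⊕ v₂ , con 62 ⊕ 2 ⊛ vh ⊕ v₁) ∷ (1 , v₁ , con 1) ∷
            (6 , con 11 , vh) ∷ [])
          (balance₂ cycA N⊆ in-W g₁∉ g₂∈ ∷ D₁≤1 ∷ 11≤h ∷ [])
        ... | no g₂∉ = farkas ρ ((1 , 8 ⊛ vh , con 60 ⊕ 2 ⊛ vh ⊕ (v₁ ⊕ v₂)) ∷ (2 , v₁ , con 1) ∷
            (1 , v₂ , v₁) ∷ (6 , con 11 , vh) ∷ [])
          (balance-none cycA N⊆ in-W g₁∉ g₂∉ ∷ D₁≤1 ∷ g₂≤g₁ ∷ 11≤h ∷ [])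

      2≤degree : ∀ {r} → (r ≢ g₂ → ¬ ∃ (g₂ A′.∼_)) → ∀ v → v ≢ r → ∃ (v A′.∼_) → 2 ≤ A′.degree v
      2≤degree no-g₂ v v≢r (u , v∼u) with support′ v∼u
      ... | here refl = ⊥-elim (no-g₂ (v≢r ∘ sym) (u , v∼u))
      ... | there v∈  = ≤-trans (s≤s (s≤s z≤n)) (7≤degree v∈)

      member : ∀ {l : List (Fin n)} → 1 ≤ length l → ∃ (_∈ l)
      member {v ∷ _} _ = v , here refl

      impossible : ⊥
      impossible with any? (g₂ A′.∼?_)
      ... | yes (x₁ , g₂∼x₁) = dead-end A′ (A′.∼-sym {g₂} {x₁} g₂∼x₁) (2≤degree is-root) (blocked is-root)
        where
        is-root : g₂ ≢ g₂ → ¬ ∃ (g₂ A′.∼_)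
        is-root g₂≢g₂ = ⊥-elim (g₂≢g₂ refl)
      ... | no ¬e with member {N} (≤-trans (s≤s z≤n) 9≤N)
      ...   | v , v∈ with ∃neighbour A′ (≤-trans (s≤s z≤n) (7≤degree v∈))
      ...     | y , v∼y = dead-end A′ {y} {v} v∼y (2≤degree (λ _ → ¬e)) (blocked (λ _ → ¬e))

    impossible : ⊥
    impossible with 2 ≤? D₁
    ... | yes 2≤D₁ = rich 2≤D₁
    ... | no ¬2≤   = Poor.impossible (s≤s⁻¹ (≰⇒> ¬2≤))

-- Removal of two separated sets.

∃-outside : ∀ {n} (l : List (Fin n)) → length l < n → ∃ (_∉ l)
∃-outside {n} l l<n with any? (λ v → ¬? (v ∈? l))
... | yes e = e
... | no ¬e = ⊥-elim (n≮n n (≤-trans (s≤s all) l<n))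
  where
  v∈ : ∀ v → v ∈ l
  v∈ v with v ∈? l
  ... | yes v∈ = v∈
  ... | no v∉  = ⊥-elim (¬e (v , v∉))
  all : n ≤ length l
  all = ≤-trans (≤-reflexive (sym (length-tabulate id))) (⊆⇒length≤ (allFin⁺ n) λ v _ → v∈ v)

module _ {n : ℕ} where

  complement : List (Fin n) → List (Fin n)
  complement l = filter (λ v → ¬? (v ∈? l)) (allFin n)

  ∈-complement⁺ : ∀ {l v} → v ∉ l → v ∈ complement l
  ∈-complement⁺ {l} {v} v∉ = ∈-filter⁺ (λ v → ¬? (v ∈? l)) (∈-allFin v) v∉

  ∈-complement⁻ : ∀ {l v} → v ∈ complement l → v ∉ l
  ∈-complement⁻ {l} v∈ = proj₂ (∈-filter⁻ (λ v → ¬? (v ∈? l)) {xs = allFin n} v∈)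

  complement-unique : ∀ l → Unique (complement l)
  complement-unique l = Unique-filter (λ v → ¬? (v ∈? l)) (allFin⁺ n)

  complement-length : ∀ {l} → Unique l → length (complement l) + length l ≡ n
  complement-length {l} ul = ≤-antisym
    (≤-trans (≤-reflexive (sym (length-++ (complement l))))
             (Unique⇒length≤ (Unique-++ (complement-unique l) ul λ { (v∈ , v∈l) → ∈-complement⁻ {l} v∈ v∈l })))
    (≤-trans (≤-reflexive (sym (length-tabulate id)))
    (≤-trans (⊆⇒length≤ (allFin⁺ n) λ v _ → in-one v) (≤-reflexive (length-++ (complement l)))))
    where
    in-one : ∀ v → v ∈ complement l ++ l
    in-one v with v ∈? l
    ... | yes v∈ = ∈-++⁺ʳ (complement l) v∈
    ... | no v∉  = ∈-++⁺ˡ (∈-complement⁺ v∉)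

module _ {n : ℕ} (A : Adjacency n) where

  open Adjacency A

  -- With `n` a variable, `allFin n` does not unfold; the value 31 enters only through the equation.
  module TwoPieces (n≡31 : n ≡ 31) (few : FewChords) (8≤degree : ∀ v → 8 ≤ degree v)
    {r} (P₁ : Piece A r) where

    module P₁ = Piece P₁
    g₁ = P₁.g
    S₁ = P₁.S
    A₁ = delete A S₁
    module A₁ = Adjacency A₁

    few₁ : A₁.FewChords
    few₁ = delete-few A S₁ few

    apart₁ : ∀ {v} → v ∉ g₁ ∷ S₁ → degree-within S₁ v ≡ 0
    apart₁ v∉ = nonadjacent-within A λ u u∈ v∼u → v∉ (P₁.closed u∈ (∼-sym v∼u))

    g₁∉S₁ : g₁ ∉ S₁
    g₁∉S₁ = Unique[x∷xs]⇒x∉xs P₁.unique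

    8≤degree₁ : ∀ {v} → v ∉ g₁ ∷ S₁ → 8 ≤ A₁.degree v
    8≤degree₁ {v} v∉ = ≤-trans (8≤degree v) (≤-trans (degree≤delete A S₁ (v∉ ∘ there))
      (≤-reflexive (trans (cong (A₁.degree v +_) (apart₁ v∉)) (+-identityʳ _))))

    not-in-S₁ : ∀ {v} → ∃ (v A₁.∼_) → v ∉ S₁
    not-in-S₁ (u , v∼u) = proj₁ (proj₂ (delete-∼⁻ A S₁ v∼u))

    module Second {r₂} (P₂ : Piece A₁ r₂) (g₁∉P₂ : g₁ ∉ Piece.S P₂) where

      module P₂ = Piece P₂
      g₂ = P₂.g
      S₂ = P₂.S
      A₂ = delete A₁ S₂
      module A₂ = Adjacency A₂
      f₁ = degree-within S₁ g₁
      f₂ = A₁.degree-within S₂ g₂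

      g₂∉S₂ : g₂ ∉ S₂
      g₂∉S₂ = Unique[x∷xs]⇒x∉xs P₂.unique

      S₂∌S₁ : ∀ {v} → v ∈ g₂ ∷ S₂ → v ∉ S₁
      S₂∌S₁ v∈ = not-in-S₁ (P₂.neighbour v∈)

      apart₂ : ∀ {v} → v ∉ g₂ ∷ S₂ → A₁.degree-within S₂ v ≡ 0
      apart₂ {v} v∉ = nonadjacent-within A₁ λ u u∈ v∼u → v∉ (P₂.closed {u} {v} u∈ (A₁.∼-sym {v} {u} v∼u))

      uS : Unique (S₁ ++ S₂)
      uS = Unique-++ (AllPairs.tail P₁.unique) (AllPairs.tail P₂.unique) λ
          { (v∈₁ , v∈₂) → S₂∌S₁ (there v∈₂) v∈₁ }

      8≤degree₂ : ∀ {v} → v ≢ g₁ → v ≢ g₂ → v ∉ S₁ ++ S₂ → 8 ≤ A₂.degree v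
      8≤degree₂ {v} v≢g₁ v≢g₂ v∉ = ≤-trans (8≤degree₁ v∉₁) (≤-trans (degree≤delete A₁ S₂ (v∉₂ ∘ there))
        (≤-reflexive (trans (cong (A₂.degree v +_) (apart₂ v∉₂)) (+-identityʳ _))))
        where
        v∉₁ : v ∉ g₁ ∷ S₁
        v∉₁ (here e)   = v≢g₁ e
        v∉₁ (there v∈) = v∉ (∈-++⁺ˡ v∈)
        v∉₂ : v ∉ g₂ ∷ S₂
        v∉₂ (here e)   = v≢g₂ e
        v∉₂ (there v∈) = v∉ (∈-++⁺ʳ S₁ v∈)

      -- Symmetric, because only `remainder` decides which of the two vertices has the larger
      -- degree.
      record Bounds (a b : Fin n) (h : ℕ) : Set where
        field
          when-9  : h ≡ 9 → 4 ≤ A₂.degree a × 4 ≤ A₂.degree b × 12 ≤ A₂.degree a + A₂.degree b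
          when-10 : h ≡ 10 → 6 ≤ A₂.degree a ⊎ 6 ≤ A₂.degree b

      remainder : ∀ {a b} → Unique (a ∷ b ∷ S₁ ++ S₂) →
          (∀ {v} → v ≢ a → v ≢ b → v ∉ S₁ ++ S₂ → 8 ≤ A₂.degree v) →
        (∀ h → h + length S₁ + length S₂ ≡ 29 → Bounds a b h) → ⊥
      remainder {a} {b} u deg bounds = finish (≤-total (A₂.degree b) (A₂.degree a))
        where
        l N : List (Fin n)
        l = a ∷ b ∷ S₁ ++ S₂
        N = complement l
        h = length N
        sizes : h + length S₁ + length S₂ ≡ 29
        sizes = +-cancelʳ-≡ 2 _ 29 (trans (regroup h (length S₁) (length S₂))
                  (trans (cong (λ k → h + (2 + k)) (sym (length-++ S₁))) (trans (complement-length u) n≡31)))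
          where
          regroup : ∀ x y z → x + y + z + 2 ≡ x + (2 + (y + z))
          regroup = solve-∀
        ρ = h ∷ length S₁ ∷ length S₂ ∷ []
        vh = var (# 0) ; s₁ = var (# 1) ; s₂ = var (# 2)
        9≤h : 9 ≤ h
        9≤h = ≮⇒≥ λ lt → farkas ρ
          ((1 , con 1 ⊕ vh , con 9) ∷ (1 , con 29 , vh ⊕ s₁ ⊕ s₂) ∷ (1 , s₁ , con 10) ∷ (1 , s₂ , con 10) ∷ [])
          (lt ∷ ≤-reflexive (sym sizes) ∷ P₁.size≤10 ∷ P₂.size≤10 ∷ [])
        h≤13 : h ≤ 13
        h≤13 = ≮⇒≥ λ lt → farkas ρ
          ((1 , con 14 , vh) ∷ (1 , vh ⊕ s₁ ⊕ s₂ , con 29) ∷ (1 , con 8 , s₁) ∷ (1 , con 8 , s₂) ∷ [])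
          (lt ∷ ≤-reflexive sizes ∷ P₁.8≤size ∷ P₂.8≤size ∷ [])
        open Bounds (bounds h sizes)
        deg-N : ∀ {v} → v ∈ N → 8 ≤ A₂.degree v
        deg-N {v} v∈ = deg (λ e → v∉ (here e)) (λ e → v∉ (there (here e))) (λ v∈S → v∉ (there (there v∈S)))
          where v∉ = ∈-complement⁻ {l = l} v∈
        outside : ∀ {u v} → u A₂.∼ v → u ∉ S₁ ++ S₂
        outside {u} {v} u∼v u∈ with delete-∼⁻ A₁ S₂ {u} {v} u∼v
        ... | u∼v₁ , u∉₂ , _ with ∈-++⁻ S₁ u∈
        ...   | inj₁ u∈₁ = not-in-S₁ (v , u∼v₁) u∈₁
        ...   | inj₂ u∈₂ = u∉₂ u∈₂
        support : ∀ {u v} → u A₂.∼ v → u ∈ a ∷ b ∷ N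
        support {u} {v} u∼v with u ≟ a | u ≟ b
        ... | yes e | _     = here e
        ... | no _  | yes e = there (here e)
        ... | no u≢a | no u≢b = there (there (∈-complement⁺ {l = l} λ
          { (here e) → u≢a e ; (there (here e)) → u≢b e ; (there (there u∈)) → outside {u} {v} u∼v u∈ }))
        few₂ : A₂.FewChords
        few₂ = delete-few A₁ S₂ few₁
        a≢b : a ≢ b
        a≢b = All.head (AllPairs.head u)
        uabN : Unique (a ∷ b ∷ N)
        uabN = (a≢b ∷ All.tabulate λ v∈ e → ∈-complement⁻ {l = l} v∈ (here (sym e)))
             ∷ (All.tabulate λ v∈ e → ∈-complement⁻ {l = l} v∈ (there (here (sym e))))
             ∷ complement-unique l
        ubaN : Unique (b ∷ a ∷ N)
        ubaN = Unique-resp-↭ (Perm.swap a b ↭-refl) uabN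
        larger : ∀ {p q} → 6 ≤ p ⊎ 6 ≤ q → q ≤ p → 6 ≤ p
        larger (inj₁ 6≤p) _   = 6≤p
        larger (inj₂ 6≤q) q≤p = ≤-trans 6≤q q≤p
        finish : A₂.degree b ≤ A₂.degree a ⊎ A₂.degree a ≤ A₂.degree b → ⊥
        finish (inj₁ b≤a) = Remainder.impossible A₂ few₂ uabN support deg-N 9≤h h≤13 b≤a
          (λ e → proj₂ (when-9 e)) (λ e → larger (when-10 e) b≤a)
        finish (inj₂ a≤b) = Remainder.impossible A₂ few₂ ubaN
          (λ u∼v → ∈-resp-↭ (Perm.swap a b ↭-refl) (support u∼v)) deg-N 9≤h h≤13 a≤b
          (λ e → proj₁ (when-9 e) , ≤-trans (proj₂ (proj₂ (when-9 e))) (≤-reflexive (+-comm (A₂.degree a) _)))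
          (λ e → larger ([ inj₂ , inj₁ ]′ (when-10 e)) a≤b)

      ρ : ℕ → ℕ → ℕ → Vec ℕ 7
      ρ h D₁ D₂ = h ∷ length S₁ ∷ length S₂ ∷ f₁ ∷ f₂ ∷ D₁ ∷ D₂ ∷ []
      vh s₁ s₂ v₁ v₂ d₁ d₂ : Linear 7
      vh = var (# 0) ; s₁ = var (# 1) ; s₂ = var (# 2) ; v₁ = var (# 3) ; v₂ = var (# 4) ; d₁ = var (# 5) ;
          d₂ = var (# 6)

      -- If `h` is 9, both sets have 10 elements; if `h` is 10, one of them has. A gate has at most
      -- `62 - 60` neighbours in a set of 10 elements and therefore keeps degree 6.
      separate-gates : g₁ ≢ g₂ → ⊥
      separate-gates g₁≢g₂ = remainder u (λ v≢g₁ v≢g₂ → 8≤degree₂ v≢g₁ v≢g₂) bounds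
        where
        g₁∉P₂′ : g₁ ∉ g₂ ∷ S₂
        g₁∉P₂′ (here e)   = g₁≢g₂ e
        g₁∉P₂′ (there g∈) = g₁∉P₂ g∈
        g₂∉P₁ : g₂ ∉ g₁ ∷ S₁
        g₂∉P₁ (here e)   = g₁≢g₂ (sym e)
        g₂∉P₁ (there g∈) = S₂∌S₁ (here refl) g∈
        u : Unique (g₁ ∷ g₂ ∷ S₁ ++ S₂)
        u = (g₁≢g₂ ∷ All.tabulate λ v∈ → λ { refl → [ g₁∉S₁ , g₁∉P₂ ]′ (∈-++⁻ S₁ v∈) })
          ∷ (All.tabulate λ v∈ → λ { refl → [ S₂∌S₁ (here refl) , g₂∉S₂ ]′ (∈-++⁻ S₁ v∈) })
          ∷ uS
        D₁ = A₂.degree g₁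
        D₂ = A₂.degree g₂
        8≤D₁ : 8 ≤ D₁ + f₁
        8≤D₁ = ≤-trans (8≤degree g₁) (≤-trans (degree≤delete A S₁ g₁∉S₁) (+-monoˡ-≤ f₁
          (≤-trans (degree≤delete A₁ S₂ g₁∉P₂)
              (≤-reflexive (trans (cong (D₁ +_) (apart₂ g₁∉P₂′)) (+-identityʳ D₁))))))
        8≤D₂ : 8 ≤ D₂ + f₂
        8≤D₂ = ≤-trans (8≤degree₁ g₂∉P₁) (degree≤delete A₁ S₂ g₂∉S₂)
        bounds : ∀ h → h + length S₁ + length S₂ ≡ 29 → Bounds g₁ g₂ h
        bounds h sizes = record
          { when-9  = λ { refl → let 6≤ = 6≤D₁ (full₁ ≤-refl) ; 6≤′ = 6≤D₂ (full₂ ≤-refl) in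
                        ≤-trans (m≤m+n 4 2) 6≤ , ≤-trans (m≤m+n 4 2) 6≤′ , +-mono-≤ 6≤ 6≤′ }
          ; when-10 = λ { refl → either sizes (10 ≤? length S₁) } }
          where
          total = ≤-reflexive (sym sizes)
          full₁ : h ≤ 9 → 10 ≤ length S₁
          full₁ h≤9 = ≮⇒≥ λ lt → farkas (ρ h D₁ D₂)
            ((1 , con 29 , vh ⊕ s₁ ⊕ s₂) ∷ (1 , s₂ , con 10) ∷ (1 , vh , con 9) ∷ (1 , con 1 ⊕ s₁ , con 10)
                ∷ [])
            (total ∷ P₂.size≤10 ∷ h≤9 ∷ lt ∷ [])
          full₂ : h ≤ 9 → 10 ≤ length S₂
          full₂ h≤9 = ≮⇒≥ λ lt → farkas (ρ h D₁ D₂)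
            ((1 , con 29 , vh ⊕ s₁ ⊕ s₂) ∷ (1 , s₁ , con 10) ∷ (1 , vh , con 9) ∷ (1 , con 1 ⊕ s₂ , con 10)
                ∷ [])
            (total ∷ P₁.size≤10 ∷ h≤9 ∷ lt ∷ [])
          6≤D₁ : 10 ≤ length S₁ → 6 ≤ D₁
          6≤D₁ 10≤ = ≮⇒≥ λ lt → farkas (ρ h D₁ D₂)
            ((1 , con 8 , d₁ ⊕ v₁) ∷ (1 , v₁ ⊕ 6 ⊛ s₁ , con 62) ∷ (6 , con 10 , s₁) ∷
                (1 , con 1 ⊕ d₁ , con 6) ∷ [])
            (8≤D₁ ∷ P₁.gate-degree ∷ 10≤ ∷ lt ∷ [])
          6≤D₂ : 10 ≤ length S₂ → 6 ≤ D₂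
          6≤D₂ 10≤ = ≮⇒≥ λ lt → farkas (ρ h D₁ D₂)
            ((1 , con 8 , d₂ ⊕ v₂) ∷ (1 , v₂ ⊕ 6 ⊛ s₂ , con 62) ∷ (6 , con 10 , s₂) ∷
                (1 , con 1 ⊕ d₂ , con 6) ∷ [])
            (8≤D₂ ∷ P₂.gate-degree ∷ 10≤ ∷ lt ∷ [])
          either : 10 + length S₁ + length S₂ ≡ 29 → Dec (10 ≤ length S₁) → 6 ≤ D₁ ⊎ 6 ≤ D₂
          either _ (yes 10≤) = inj₁ (6≤D₁ 10≤)
          either h≡ (no 10≰) = inj₂ (6≤D₂ (≮⇒≥ λ lt → farkas (ρ h D₁ D₂)
            ((1 , con 29 , con 10 ⊕ s₁ ⊕ s₂) ∷ (1 , con 1 ⊕ s₁ , con 10) ∷ (1 , con 1 ⊕ s₂ , con 10) ∷ [])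
            (≤-reflexive (sym h≡) ∷ ≰⇒> 10≰ ∷ lt ∷ [])))

      -- Any further vertex `b` takes the second place. If `h` is 9, the gate loses at most 2
      -- neighbours to each set and keeps degree 4, while `b` has degree 8.
      common-gate : g₁ ≡ g₂ → ⊥
      common-gate g₁≡g₂ with ∃-outside (g₂ ∷ S₁ ++ S₂)
          (subst (length (g₂ ∷ S₁ ++ S₂) <_) (sym n≡31) (s≤s (s≤s (≤-trans (≤-reflexive (length-++ S₁ {S₂}))
                               (≤-trans (+-mono-≤ P₁.size≤10 P₂.size≤10) (m≤m+n 20 9))))))
      ... | b , b∉ = remainder u (λ v≢g₂ _ → 8≤degree₂ (λ e → v≢g₂ (trans e g₁≡g₂)) v≢g₂) bounds
        where
        g₂∉S₁ : g₂ ∉ S₁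
        g₂∉S₁ = S₂∌S₁ (here refl)
        u : Unique (g₂ ∷ b ∷ S₁ ++ S₂)
        u = ((λ e → b∉ (here (sym e))) ∷ All.tabulate λ v∈ → λ { refl → [ g₂∉S₁ , g₂∉S₂ ]′ (∈-++⁻ S₁ v∈) })
          ∷ (All.tabulate λ v∈ → λ { refl → b∉ (there v∈) })
          ∷ uS
        D₁ = A₂.degree g₂
        D₂ = A₂.degree b
        8≤D₁ : 8 ≤ D₁ + f₂ + f₁
        8≤D₁ = ≤-trans (8≤degree g₁) (≤-trans (degree≤delete A S₁ g₁∉S₁) (+-monoˡ-≤ f₁
          (subst (λ g → A₁.degree g ≤ D₁ + f₂) (sym g₁≡g₂) (degree≤delete A₁ S₂ g₂∉S₂))))
        8≤D₂ : 8 ≤ D₂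
        8≤D₂ = 8≤degree₂ (λ e → b∉ (here (trans e g₁≡g₂))) (λ e → b∉ (here e)) (b∉ ∘ there)
        bounds : ∀ h → h + length S₁ + length S₂ ≡ 29 → Bounds g₂ b h
        bounds h sizes = record
          { when-9  = λ { refl → 4≤D₁ ≤-refl , ≤-trans (m≤m+n 4 4) 8≤D₂ , +-mono-≤ (4≤D₁ ≤-refl) 8≤D₂ }
          ; when-10 = λ _ → inj₂ (≤-trans (m≤m+n 6 2) 8≤D₂) }
          where
          4≤D₁ : h ≤ 9 → 4 ≤ D₁
          4≤D₁ h≤9 = ≮⇒≥ λ lt → farkas (ρ h D₁ D₂)
            ( (1 , con 8 , d₁ ⊕ v₂ ⊕ v₁) ∷ (1 , v₁ ⊕ 6 ⊛ s₁ , con 62) ∷ (1 , v₂ ⊕ 6 ⊛ s₂ , con 62)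
            ∷ (6 , con 29 , vh ⊕ s₁ ⊕ s₂) ∷ (6 , vh , con 9) ∷ (1 , con 1 ⊕ d₁ , con 4) ∷ [])
            (8≤D₁ ∷ P₁.gate-degree ∷ P₂.gate-degree ∷ ≤-reflexive (sym sizes) ∷ h≤9 ∷ lt ∷ [])

      impossible : ⊥
      impossible with g₁ ≟ g₂
      ... | yes e = common-gate e
      ... | no ne = separate-gates ne

    -- As the root, `g₁` stays out of the second set. If it has no edge left, it is in no piece
    -- anyway, and any root will do.
    impossible : ⊥
    impossible with any? (g₁ A₁.∼?_)
    ... | yes (x₁ , g₁∼x₁) = piece A₁ few₁ (A₁.∼-sym {g₁} {x₁} g₁∼x₁) deg λ P₂ → Second.impossible P₂
        (Piece.root∉ P₂)
      where
      deg : ∀ v → v ≢ g₁ → ∃ (v A₁.∼_) → 8 ≤ A₁.degree v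
      deg v v≢g₁ nb = 8≤degree₁ λ { (here e) → v≢g₁ e ; (there v∈) → not-in-S₁ nb v∈ }
    ... | no ¬e with ∃-outside (g₁ ∷ S₁)
        (subst (length (g₁ ∷ S₁) <_) (sym n≡31) (s≤s (s≤s (≤-trans P₁.size≤10 (m≤m+n 10 19)))))
    ...   | x₁ , x₁∉ with ∃neighbour A₁ {x₁} (≤-trans (s≤s z≤n) (8≤degree₁ x₁∉))
    ...     | y , x₁∼y = piece A₁ few₁ {y} {x₁} x₁∼y deg λ P₂ → Second.impossible P₂ λ g₁∈ → ¬e
        (Piece.neighbour P₂ (there g₁∈))
      where
      deg : ∀ v → v ≢ y → ∃ (v A₁.∼_) → 8 ≤ A₁.degree v
      deg v _ nb = 8≤degree₁ λ { (here refl) → ¬e nb ; (there v∈) → not-in-S₁ nb v∈ }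

many-chords : (A : Adjacency 31) → (∀ v → 8 ≤ Adjacency.degree A v) → ¬ Adjacency.FewChords A
many-chords A 8≤degree few with ∃neighbour A {# 0} (≤-trans (s≤s z≤n) (8≤degree (# 0)))
... | x₁ , 0∼x₁ = piece A few (∼-sym 0∼x₁) (λ v _ _ → 8≤degree v) (TwoPieces.impossible A refl few 8≤degree)
  where open Adjacency A

-- From lists to `Cycle`: counting chords and exhaustive search.

∑-map : ∀ {A B : Set} (f : B → A) l (w : A → ℕ) → ∑ (map f l) w ≡ ∑ l (w ∘ f)
∑-map f []      w = refl
∑-map f (x ∷ l) w = cong (w (f x) +_) (∑-map f l w)

module _ {A : Set} where

  ∑-lookup : ∀ (l : List A) (w : A → ℕ) → ∑ l w ≡ ∑ (allFin (length l)) (w ∘ lookup l)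
  ∑-lookup l w = trans (cong (λ k → ∑ k w) (trans (sym (tabulate-lookup l)) (sym (map-tabulate id (lookup l)))))
                       (∑-map (lookup l) (allFin (length l)) w)

  ∑-× : ∀ {B : Set} (k : List A) (l : List B) (w : A × B → ℕ) →
        ∑ (cartesianProduct k l) w ≡ ∑ k (λ x → ∑ l (λ y → w (x , y)))
  ∑-× []      l w = refl
  ∑-× (x ∷ k) l w = trans (∑-++ (map (x ,_) l) (cartesianProduct k l) w)
      (cong₂ _+_ (∑-map (x ,_) l w) (∑-× k l w))

  length-filter-∑ : ∀ {P : U.Pred A 0ℓ} (P? : U.Decidable P) l → length (filter P? l) ≡ ∑ l
      (λ x → ⟦ does (P? x) ⟧)
  length-filter-∑ P? []      = refl
  length-filter-∑ P? (x ∷ l) with does (P? x)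
  ... | true  = cong suc (length-filter-∑ P? l)
  ... | false = length-filter-∑ P? l

  lookup-unique : ∀ {l : List A} → Unique l → Injective _≡_ _≡_ (lookup l)
  lookup-unique (x∉ ∷ u) {zero}  {zero}  _  = refl
  lookup-unique (x∉ ∷ u) {zero}  {suc j} eq = ⊥-elim (All.lookup x∉ (∈-lookup j) eq)
  lookup-unique (x∉ ∷ u) {suc i} {zero}  eq = ⊥-elim (All.lookup x∉ (∈-lookup i) (sym eq))
  lookup-unique (x∉ ∷ u) {suc i} {suc j} eq = cong suc (lookup-unique u eq)

  lookup-last : ∀ (x : A) c → lookup (x ∷ c) (fromℕ (length c)) ≡ lastOr x c
  lookup-last x []      = refl
  lookup-last x (y ∷ c) = lookup-last y c

  lookup-linked : ∀ {R : Rel A 0ℓ} {x c} → Linked R (x ∷ c) → ∀ j → R (lookup (x ∷ c) (inject₁ j)) (lookup c j)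
  lookup-linked (r ∷ p) zero    = r
  lookup-linked (r ∷ p) (suc j) = lookup-linked p j

∑-indicator : ∀ {n} (x : Fin n) → ∑ (allFin n) (indicator x) ≡ 1
∑-indicator {n} x = ≤-antisym
  (≤-trans (∑-⊆ {l = [ x ]} (indicator x) (allFin⁺ n) λ u _ → only u)
           (≤-reflexive (trans (+-identityʳ _) (indicator-refl x))))
  (1≤∑indicator (∈-allFin x))
  where
  only : ∀ u → indicator x u ≡ 0 ⊎ u ∈ [ x ]
  only u with toSum (x ≟ u)
  ... | inj₁ refl = inj₂ (here refl)
  ... | inj₂ x≢u  = inj₁ (indicator-≢ x≢u)

next-inject₁ : ∀ {k} (j : Fin k) → next (inject₁ j) ≡ suc j
next-inject₁ {k} j = toℕ-injective (trans (toℕ-fromℕ< _)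
  (trans (cong (λ m → suc m Data.Nat.% suc k) (toℕ-inject₁ j)) (m<n⇒m%n≡m (s≤s (toℕ<n j)))))

next-fromℕ : ∀ k → next (fromℕ k) ≡ zero
next-fromℕ k = toℕ-injective (trans (toℕ-fromℕ< _)
  (trans (cong (λ m → suc m Data.Nat.% suc k) (toℕ-fromℕ k)) (n%n≡0 (suc k))))

next-cases : ∀ {k} (i : Fin (suc k)) → toℕ (next i) ≡ suc (toℕ i) ⊎ (toℕ i ≡ k × toℕ (next i) ≡ 0)
next-cases {k} i with view i
... | ‵fromℕ     = inj₂ (toℕ-fromℕ k , cong toℕ (next-fromℕ k))
... | ‵inject₁ j = inj₁ (trans (cong toℕ (next-inject₁ j)) (cong suc (sym (toℕ-inject₁ j))))

-- Two positions that follow each other both ways make up the whole cycle; length 3 thus keeps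
-- `chord-sum` from counting an edge twice.
next-asym : ∀ {k} → 3 ≤ k → ∀ {i j : Fin k} → next i ≡ j → next j ≢ i
next-asym {suc k} (s≤s 2≤k) {i} refl eq with next-cases i | next-cases (next i)
... | inj₁ a | inj₁ b = m≢1+n+m (toℕ i) (trans (cong toℕ (sym eq)) (trans b (cong suc a)))
... | inj₁ a | inj₂ (b , c) = n≮n 1
    (≤-trans 2≤k (≤-reflexive (trans (sym b) (trans a (cong suc (trans (cong toℕ (sym eq)) c))))))
... | inj₂ (a , b) | inj₁ c = n≮n 1
    (≤-trans 2≤k (≤-reflexive (trans (sym a) (trans (cong toℕ (sym eq)) (trans c (cong suc b))))))
... | inj₂ (a , b) | inj₂ (c , d) = n≮0 (≤-trans (≤-trans (s≤s z≤n) 2≤k) (≤-reflexive (trans (sym c) b)))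

module _ {n : ℕ} (G : Graph n) where

  open Graph G

  adjacency : Adjacency n
  adjacency = record
    { adj     = λ u v → does (u ~? v)
    ; adj-sym = λ u v → symmetric u v (toSum (u ~? v))
    ; adj-irr = λ v → dec-false (v ~? v) (~-irr v)
    }
    where
    symmetric : ∀ u v → u ~ v ⊎ ¬ u ~ v → does (u ~? v) ≡ does (v ~? u)
    symmetric u v (inj₁ u~v) = trans (dec-true (u ~? v) u~v) (sym (dec-true (v ~? u) (~-sym u~v)))
    symmetric u v (inj₂ ¬uv) = trans (dec-false (u ~? v) ¬uv) (sym (dec-false (v ~? u) (¬uv ∘ ~-sym)))

  open Adjacency adjacency using (∣_∼∣; _∼_; IsCycle) renaming (degree to adj-degree)

  ∼⇒~ : ∀ {u v} → u ∼ v → u ~ v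
  ∼⇒~ {u} {v} e with u ~? v
  ... | yes u~v = u~v

  degree≡ : ∀ v → degree v ≡ adj-degree v
  degree≡ v = length-filter-∑ (v ~?_) (allFin n)

  module _ (C : Cycle G) where
    open Cycle C

    -- Each ordered adjacent pair is a chord or one of the `len` edges of the cycle, and both kinds
    -- occur in two orders.
    chord-sum : ∑ (allFin len) (λ i → ∑ (allFin len) (λ j → ∣ vertex i ∼∣ (vertex j))) ≡ 2 * #chords + 2 * len
    chord-sum = begin
      ∑ I (λ i → ∑ I (λ j → ∣ vertex i ∼∣ (vertex j)))
        ≡⟨ ∑-cong I (λ i _ → trans (∑-cong I λ j _ → pointwise i j)
             (trans (∑-+ I (λ j → chord i j + chord j i) (λ j → step i j + step j i))
                    (cong₂ _+_ (∑-+ I (chord i) (λ j → chord j i)) (∑-+ I (step i) (λ j → step j i))))) ⟩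
      ∑ I (λ i → (∑ I (chord i) + ∑ I (λ j → chord j i)) + (∑ I (step i) + ∑ I (λ j → step j i)))
        ≡⟨ trans (∑-+ I _ _) (cong₂ _+_ (∑-+ I _ _) (∑-+ I _ _)) ⟩
      (∑ I (λ i → ∑ I (chord i)) + ∑ I (λ i → ∑ I (λ j → chord j i))) +
          (∑ I (λ i → ∑ I (step i)) + ∑ I (λ i → ∑ I (λ j → step j i)))
        ≡⟨ cong₂ _+_ (cong₂ _+_ chords-once (trans (∑-swap I I (λ i j → chord j i)) chords-once))
                     (cong₂ _+_ steps-once (trans (∑-swap I I (λ i j → step j i)) steps-once)) ⟩
      (#chords + #chords) + (len + len)
        ≡⟨ double #chords len ⟩
      2 * #chords + 2 * len ∎
      where
      open Relation.Binary.PropositionalEquality.≡-Reasoning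
      I = allFin len
      chord step : Fin len → Fin len → ℕ
      chord i j = ⟦ does (isChord? (i , j)) ⟧
      step i j  = indicator (next i) j
      double : ∀ a b → (a + a) + (b + b) ≡ 2 * a + 2 * b
      double = solve-∀
      chords-once : ∑ I (λ i → ∑ I (chord i)) ≡ #chords
      chords-once = sym (trans (length-filter-∑ isChord? (cartesianProduct I I))
          (∑-× I I λ p → ⟦ does (isChord? p) ⟧))
      steps-once : ∑ I (λ i → ∑ I (step i)) ≡ len
      steps-once = trans (∑-cong I λ i _ → ∑-indicator (next i))
        (trans (∑-const I 1) (trans (*-identityʳ _) (Data.List.Properties.length-tabulate id)))
      is-chord : ∀ {i j} → IsChord (i , j) → chord i j ≡ 1
      is-chord {i} {j} ch = cong ⟦_⟧ (dec-true (isChord? (i , j)) ch)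
      no-chord : ∀ {i j} → ¬ IsChord (i , j) → chord i j ≡ 0
      no-chord {i} {j} ch = cong ⟦_⟧ (dec-false (isChord? (i , j)) ch)
      edge-yes : ∀ {i j} → vertex i ~ vertex j → ∣ vertex i ∼∣ (vertex j) ≡ 1
      edge-yes {i} {j} e = cong ⟦_⟧ (dec-true (vertex i ~? vertex j) e)
      step-yes : ∀ {i j} → next i ≡ j → step i j ≡ 1
      step-yes {i} refl = indicator-refl (next i)
      pointwise : ∀ i j → ∣ vertex i ∼∣ (vertex j) ≡ (chord i j + chord j i) + (step i j + step j i)
      pointwise i j with toSum (next i ≟ j) | toSum (next j ≟ i)
      ... | inj₁ p | inj₁ q = ⊥-elim (next-asym 3≤len p q)
      ... | inj₁ p | inj₂ q = trans (edge-yes (subst (λ k → vertex i ~ vertex k) p (edge i))) (sym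
        (cong₂ _+_ (cong₂ _+_ (no-chord λ ch → proj₂ (proj₂ ch) (inj₁ p))
            (no-chord λ ch → proj₂ (proj₂ ch) (inj₂ p)))
                   (cong₂ _+_ (step-yes p) (indicator-≢ q))))
      ... | inj₂ p | inj₁ q = trans (edge-yes (~-sym (subst (λ k → vertex j ~ vertex k) q (edge j)))) (sym
        (cong₂ _+_ (cong₂ _+_ (no-chord λ ch → proj₂ (proj₂ ch) (inj₂ q))
            (no-chord λ ch → proj₂ (proj₂ ch) (inj₁ q)))
                   (cong₂ _+_ (indicator-≢ p) (step-yes q))))
      ... | inj₂ p | inj₂ q with toSum (vertex i ~? vertex j)
      ...   | inj₂ ¬e = trans (cong ⟦_⟧ (dec-false (vertex i ~? vertex j) ¬e)) (sym
        (cong₂ _+_ (cong₂ _+_ (no-chord λ ch → ¬e (proj₁ (proj₂ ch)))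
            (no-chord λ ch → ¬e (~-sym (proj₁ (proj₂ ch)))))
                   (cong₂ _+_ (indicator-≢ p) (indicator-≢ q))))
      ...   | inj₁ e = trans (edge-yes e) (sym (cong₂ _+_ one (cong₂ _+_ (indicator-≢ p) (indicator-≢ q))))
        where
        one : chord i j + chord j i ≡ 1
        one with Fin-<-cmp i j
        ... | tri< i<j _ j≮i = cong₂ _+_ (is-chord (i<j , e , [ p , q ]′)) (no-chord λ ch → j≮i (proj₁ ch))
        ... | tri> i≮j _ j<i = cong₂ _+_ (no-chord λ ch → i≮j (proj₁ ch))
            (is-chord (j<i , ~-sym e , [ q , p ]′))
        ... | tri≈ _ refl _  = ⊥-elim (~-irr (vertex i) e)

  cycle : ∀ {x c} → IsCycle x c → Cycle G
  cycle {x} {c} cyc = record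
    { len        = length (x ∷ c)
    ; 3≤len      = long
    ; vertex     = lookup (x ∷ c)
    ; vertex-inj = lookup-unique unique
    ; edge       = edge
    }
    where
    open IsCycle cyc
    edge : ∀ i → lookup (x ∷ c) i ~ lookup (x ∷ c) (next i)
    edge i with view i
    ... | ‵fromℕ     rewrite next-fromℕ (length c) | lookup-last x c = ~-sym (∼⇒~ closing)
    ... | ‵inject₁ j rewrite next-inject₁ j = ∼⇒~ (lookup-linked linked j)

  -- A decidable form of a counterexample to `FewChords`.
  Exceeds : List (Fin n) → Set
  Exceeds []      = ⊥
  Exceeds (x ∷ c) = IsCycle x c × 60 + 2 * length (x ∷ c) < ∑ (x ∷ c) (λ u → ∑ (x ∷ c) ∣ u ∼∣)

  exceeds⇒31 : ∀ {x c} (e : Exceeds (x ∷ c)) → 31 ≤ Cycle.#chords (cycle (proj₁ e))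
  exceeds⇒31 {x} {c} (cyc , lt) = ≮⇒≥ λ few → farkas (Cycle.#chords (cycle cyc) ∷ length (x ∷ c) ∷ [])
    ( (1 , con 1 ⊕ (con 60 ⊕ 2 ⊛ var (# 1)) , 2 ⊛ var (# 0) ⊕ 2 ⊛ var (# 1))
    ∷ (2 , con 1 ⊕ var (# 0) , con 31) ∷ [])
    (≤-trans lt (≤-reflexive sums) ∷ few ∷ [])
    where
    l = x ∷ c
    sums : ∑ l (λ u → ∑ l ∣ u ∼∣) ≡ 2 * Cycle.#chords (cycle cyc) + 2 * length l
    sums = trans (∑-lookup l (λ u → ∑ l ∣ u ∼∣))
      (trans (∑-cong (allFin (length l)) λ i _ → ∑-lookup l ∣ lookup l i ∼∣) (chord-sum (cycle cyc)))

  exceeds? : ∀ l → Dec (Exceeds l)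
  exceeds? []      = no λ ()
  exceeds? (x ∷ c) = cycle? ×-dec (_ Data.Nat.<? _)
    where
    open Adjacency adjacency using (_∼?_)
    open import Data.List.Relation.Unary.Unique.DecPropositional (_≟_ {n}) using (unique?)
    cycle? : Dec (IsCycle x c)
    cycle? = map′ (λ { (a , b , d , e) → record { linked = a ; unique = b ; closing = d ; long = e } })
      (λ y → IsCycle.linked y , IsCycle.unique y , IsCycle.closing y , IsCycle.long y)
      (Linked.linked? _∼?_ (x ∷ c) ×-dec unique? (x ∷ c) ×-dec (x ∼? lastOr x c) ×-dec (3 ≤? length (x ∷ c)))

∃-list≤? : ∀ {n} {P : List (Fin n) → Set} k → (∀ l → Dec (P l)) → Dec (∃ λ l → length l ≤ k × P l)
∃-list≤? zero P? = map′ (λ p → [] , z≤n , p) (λ { ([] , _ , p) → p }) (P? [])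
∃-list≤? (suc k) P? = map′
  (λ { (inj₁ p) → [] , z≤n , p ; (inj₂ (x , l , le , p)) → x ∷ l , s≤s le , p })
  (λ { ([] , _ , p) → inj₁ p ; (x ∷ l , s≤s le , p) → inj₂ (x , l , le , p) })
  (P? [] ⊎-dec any? λ x → ∃-list≤? k (λ l → P? (x ∷ l)))

-- The counting only refutes `FewChords`; as cycles have at most `n` vertices, a finite search turns
-- the refutation into a cycle.
forces-31 : ∀ {n} (G : Graph n) → ¬ Adjacency.FewChords (adjacency G) → Σ (Cycle G) λ C → 31 ≤ Cycle.#chords C
forces-31 {n} G ¬few with ∃-list≤? n (exceeds? G)
... | yes (x ∷ c , _ , e) = cycle G (proj₁ e) , exceeds⇒31 G e
... | no none = ⊥-elim (¬few λ {x} {c} cyc → ≮⇒≥ λ lt →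
  none (x ∷ c , Unique⇒length≤ (Adjacency.IsCycle.unique cyc) , cyc , lt))

upper : ForcesChords 31 31 8
upper G 8≤degree = forces-31 G (many-chords (adjacency G) λ v → ≤-trans (8≤degree v)
    (≤-reflexive (degree≡ G v)))

-- The lower bound.

-- Three components: on 0–9 and on 10–19 the complement of a 10-cycle, and on 20–30 the complement
-- of an 11-cycle together with the five edges {20 + i, 25 + i}, i < 5; all degrees are 7, but 30 has degree 8.
component : Fin 31 → ℕ
component v = if toℕ v <ᵇ 10 then 0 else if toℕ v <ᵇ 20 then 1 else 2

joined : Fin 31 → Fin 31 → Bool
joined u v = (component u ≡ᵇ component v) ∧ not (missing (component u) ∣ toℕ u - toℕ v ∣)
  where
  missing : ℕ → ℕ → Bool
  missing 2 5 = (toℕ u ⊓ toℕ v) <ᵇ 25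
  missing 2 d = (d <ᵇ 2) ∨ (d ≡ᵇ 10)
  missing _ d = (d <ᵇ 2) ∨ (d ≡ᵇ 9)

sparse : Graph 31
sparse = record
  { _~_   = λ u v → joined u v ≡ true
  ; _~?_  = λ u v → joined u v Bool.≟ true
  ; ~-sym = λ {u} {v} u~v → trans
      (toWitness {a? = all? λ u → all? λ v → joined v u Bool.≟ joined u v} _ u v) u~v
  ; ~-irr = toWitness {a? = all? λ v → ¬? (joined v v Bool.≟ true)} _
  }

open Graph sparse

degree≥7 : MinDegreeAtLeast 7 sparse
degree≥7 = toWitness {a? = all? λ v → 7 ≤? degree v} _

degree≤7 : ∀ v → degree v ≤ 7 + indicator (# 30) v
degree≤7 = toWitness {a? = all? λ v → degree v ≤? 7 + indicator (# 30) v} _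

~-component : ∀ u v → u ~ v → component u ≡ component v
~-component = toWitness {a? = all? λ u → all? λ v → (u ~? v) →-dec (component u Data.Nat.≟ component v)} _

component-size : ∀ v → length (filter (λ u → component v Data.Nat.≟ component u) (allFin 31)) ≤ 11
component-size = toWitness {a? = all? λ v → length
    (filter (λ u → component v Data.Nat.≟ component u) (allFin 31)) ≤? 11} _

-- A cycle stays within a component, so `2 * #chords ≤ 5 * len + 1 ≤ 56`; the 1 is due to the vertex
-- 30.
few-chords : (C : Cycle sparse) → Cycle.#chords C ≤ 28
few-chords C = bound len refl
  where
  open Cycle C
  l : List (Fin 31)
  l = map vertex (allFin len)
  unique-l : Unique l
  unique-l = map⁺ vertex-inj (allFin⁺ len)
  length-l : length l ≡ len
  length-l = trans (length-map vertex (allFin len)) (length-tabulate id)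
  degrees : ∑ (allFin len) (λ i → ∑ (allFin len)
      (λ j → Adjacency.∣_∼∣ (adjacency sparse) (vertex i) (vertex j))) ≤ 7 * len + 1
  degrees = begin
    ∑ (allFin len) (λ i → ∑ (allFin len) (λ j → a (vertex i) (vertex j)))
      ≡⟨ trans (∑-cong (allFin len) λ i _ → sym (∑-map vertex (allFin len) (a (vertex i))))
          (sym (∑-map vertex (allFin len) λ v → ∑ l (a v))) ⟩
    ∑ l (λ v → ∑ l (a v))
      ≤⟨ ∑-mono l (λ v _ → ≤-trans (Adjacency.within≤degree (adjacency sparse) {v} unique-l)
          (≤-trans (≤-reflexive (sym (degree≡ sparse v))) (degree≤7 v))) ⟩
    ∑ l (λ v → 7 + indicator (# 30) v)
      ≡⟨ ∑-+ l (const 7) (indicator (# 30)) ⟩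
    ∑ l (const 7) + ∑ l (indicator (# 30))
      ≤⟨ +-mono-≤ (≤-reflexive (trans (∑-const l 7) (trans (cong (_* 7) length-l) (*-comm len 7))))
                  (≤-trans (∑-⊆ (indicator (# 30)) unique-l λ v _ → inj₂ (∈-allFin v))
                      (≤-reflexive (∑-indicator {31} (# 30)))) ⟩
    7 * len + 1 ∎
    where
    open ≤-Reasoning
    a : Fin 31 → Fin 31 → ℕ
    a = Adjacency.∣_∼∣ (adjacency sparse)
  bound : ∀ k → len ≡ k → #chords ≤ 28
  bound zero eq = ⊥-elim (n≮0 (≤-trans 3≤len (≤-reflexive eq)))
  bound (suc k) eq = ≮⇒≥ λ lt → farkas (#chords ∷ len ∷ [])
    ((1 , 2 ⊛ var (# 0) ⊕ 2 ⊛ var (# 1) , 7 ⊛ var (# 1) ⊕ con 1) ∷ (2 , con 29 , var (# 0)) ∷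
        (5 , var (# 1) , con 11) ∷ [])
    (≤-trans (≤-reflexive (sym (chord-sum sparse C))) degrees ∷ lt ∷ len≤11 ∷ [])
    where
    same : ∀ {m} (f : Fin (suc m) → Fin 31) → (∀ i → f i ~ f (next i)) → ∀ i → component (f zero) ≡
        component (f i)
    same f e i = go (toℕ i) i refl
      where
      go : ∀ m i → toℕ i ≡ m → component (f zero) ≡ component (f i)
      go m zero _ = refl
      go (suc m) (suc i) eq = trans (go m (inject₁ i) (trans (toℕ-inject₁ i) (suc-injective eq)))
        (trans (~-component (f (inject₁ i)) _ (e (inject₁ i))) (cong (component ∘ f) (next-inject₁ i)))
    same-component : ∀ {m} → m ≡ suc k → (f : Fin m → Fin 31) → (∀ i → f i ~ f (next i)) → ∃ λ v → ∀ i →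
        component v ≡ component (f i)
    same-component refl f e = f zero , same f e
    len≤11 : len ≤ 11
    len≤11 with same-component eq vertex edge
    ... | v , in-component = ≤-trans (≤-reflexive (sym length-l))
        (≤-trans (⊆⇒length≤ unique-l member) (component-size v))
      where
      member : ∀ u → u ∈ l → u ∈ filter (λ u → component v Data.Nat.≟ component u) (allFin 31)
      member u u∈ with ∈-map⁻ vertex u∈
      ... | i , _ , refl = ∈-filter⁺ (λ u → component v Data.Nat.≟ component u) (∈-allFin u) (in-component i)

theorem1p12 : f⟨ 31 , 31 ⟩≡ 8
theorem1p12 = upper , λ d forced → ≮⇒≥ λ d<8 →
  let C , 31≤ = forced sparse (λ v → ≤-trans (s≤s⁻¹ d<8) (degree≥7 v))
  in n≮n 28 (≤-trans (m≤m+n 29 2) (≤-trans 31≤ (few-chords C)))
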